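{- Let $\tilde\omega=\log^*\tilde\delta$, computed in the convolution algebra of $(\mathcal A,\diamond,\Delta_{\mathcal A})$. Then $\tilde\omega(\mathbf 1)=0$ and $\tilde\omega(x^s)=\frac{(-1)^{s+1}}{s}$ for $s\ge1$, and $$\omega=\tilde\omega\circ\Lambda,$$ where $\omega=\log^*\delta$ in the convolution algebra of $\mathcal H_{CK}$.
   Context: Let $k$ be a field of characteristic $0$. $\mathcal A=k[x]$ ($x^0=\mathbf 1$) with the quasi-shuffle product $\diamond$ determined by $\mathbf 1\diamond u=u\diamond\mathbf 1=u$, $x^k\diamond x^l=(x^{k-1}\diamond x^l)x+(x^k\diamond x^{l-1})x+(x^{k-1}\diamond x^{l-1})x$ for $k,l\ge1$, and the deconcatenation coproduct $\Delta_{\mathcal A}(x^n)=\sum_{r=0}^nx^r\otimes x^{n-r}$, is a connected graded Hopf algebra with counit $\varepsilon_{\mathcal A}$. $\tilde\delta:\mathcal A\to k$ is linear with $\tilde\delta(\mathbf 1)=\tilde\delta(x)=1$, $\tilde\delta(x^s)=0$ for $s\ge2$. $\mathcal H_{CK}$ is the Connes–Kreimer Hopf algebra of rooted forests (free commutative algebra on nonempty non-planar rooted trees, unit the empty forest, counit $\varepsilon$, coproduct by admissible cuts: $\Delta_{CK}(u)=\sum v\otimes w$ over decompositions of the vertex set of $u$ into $V\sqcup W$ such that no vertex of $V$ lies strictly below a vertex of $W$, $v,w$ the induced forests). $B_+$ grafts a forest onto a new root; $\Lambda:\mathcal H_{CK}\to\mathcal A$ is the unique unital algebra morphism with $\Lambda(B_+(t_1\cdots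 t_n))=(\Lambda(t_1)\diamond\cdots\diamond\Lambda(t_n))x$ (it is a Hopf algebra morphism). $\delta$ is the character of $\mathcal H_{CK}$ with $\delta(\bullet)=1$ and $\delta(t)=0$ for trees with at least two vertices. For a character $\chi$ of either Hopf algebra, $\log^*\chi=\sum_{n\ge1}\frac{(-1)^{n+1}}{n}(\chi-\text{counit})^{*n}$, with $*$ the convolution product. -}

module Defs where

open import Level using (Level; 0ℓ; _⊔_)
open import Algebra.Bundles using (CommutativeRing; CommutativeMonoid; RawRing)
open import Algebra.Apartness.Bundles using (HeytingCommutativeRing; HeytingField)
import Algebra.Solver.CommutativeMonoid as CommutativeMonoidSolver
import Algebra.Definitions.RawSemiring as SemiringDefinitions
import Algebra.Properties.CommutativeSemigroup as CommutativeSemigroupProperties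
import Algebra.Properties.Ring as RingProperties
open import Data.Bool using (if_then_else_)
open import Data.Empty using (⊥-elim)
open import Data.List using (List; []; _∷_; _++_; map; concatMap; length; filter; cartesianProductWith; upTo)
open import Data.List.Properties using (length-++; ++-assoc; ++-identityʳ; map-++)
open import Data.List.Membership.Propositional using (_∉_)
import Data.List.Membership.DecPropositional as DecMembership
open import Data.List.Relation.Unary.All using (All; []; _∷_)
import Data.List.Relation.Unary.All as All
import Data.List.Relation.Unary.All.Properties as All
open import Data.List.Relation.Binary.Pointwise.Base using (Pointwise; []; _∷_)
open import Data.List.Relation.Binary.Permutation.Homogeneous using (Permutation; refl; prep; swap; trans)
open import Data.List.Relation.Binary.Permutation.Propositional as ↭ using (_↭_)
import Data.List.Relation.Binary.Permutation.Propositional.Properties as ↭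
import Data.List.Relation.Binary.Permutation.Setoid.Properties as PermSetoid
open import Data.Nat using (ℕ; zero; suc; _≤_; _<_; z≤n; s≤s; NonZero)
import Data.Nat as ℕ
import Data.Nat.Properties as ℕ
open import Data.Product using (_×_; _,_; proj₁; proj₂; map₂)
open import Data.Product.Relation.Binary.Pointwise.NonDependent using (×-setoid)
open import Data.Unit using (⊤; tt)
open import Function using (_∘_; Func)
open import Relation.Binary.Bundles using (Setoid)
open import Relation.Binary.Core using (Rel)
open import Relation.Binary.PropositionalEquality as ≡ using (_≡_)
import Relation.Binary.Reasoning.Setoid as SetoidReasoning
open import Relation.Nullary using (Dec; yes; no; does)
open import Relation.Nullary.Decidable using (_×-dec_; _→-dec_; ¬?)

module Linear {c ℓ : Level} (R : CommutativeRing c ℓ) where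

  open CommutativeRing R renaming (refl to ≈-refl; sym to ≈-sym; trans to ≈-trans)

  module FreeModule (B : Setoid 0ℓ 0ℓ) where
    open Setoid B using () renaming (Carrier to ∣B∣; _≈_ to _≈ᴮ_; refl to ≈ᴮ-refl)

    Comb : Set c
    Comb = List (Carrier × ∣B∣)

    infix 4 _≋_

    -- The congruence that turns formal sums into the free R-module on B.
    data _≋_ : Rel Comb (c ⊔ ℓ) where
      refl  : ∀ {u} → u ≋ u
      sym   : ∀ {u v} → u ≋ v → v ≋ u
      trans : ∀ {u v w} → u ≋ v → v ≋ w → u ≋ w
      cons  : ∀ {a a₁ b b₁ u v} → a ≈ a₁ → b ≈ᴮ b₁ → u ≋ v → (a , b) ∷ u ≋ (a₁ , b₁) ∷ v
      swap  : ∀ x y {u} → x ∷ y ∷ u ≋ y ∷ x ∷ u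
      merge : ∀ a a₁ b {u} → (a , b) ∷ (a₁ , b) ∷ u ≋ (a + a₁ , b) ∷ u
      drop  : ∀ b {u} → (0# , b) ∷ u ≋ u

    η : ∣B∣ → Comb
    η b = (1# , b) ∷ []

    infixr 7 _·_
    _·_ : Carrier → Comb → Comb
    a · []            = []
    a · ((x , b) ∷ u) = (a * x , b) ∷ a · u

    ++-congˡ : ∀ u {v w} → v ≋ w → u ++ v ≋ u ++ w
    ++-congˡ []            p = p
    ++-congˡ ((a , b) ∷ u) p = cons ≈-refl ≈ᴮ-refl (++-congˡ u p)

    ++-congʳ : ∀ {u v} w → u ≋ v → u ++ w ≋ v ++ w
    ++-congʳ w refl           = refl
    ++-congʳ w (sym p)        = sym (++-congʳ w p)
    ++-congʳ w (trans p q)    = trans (++-congʳ w p) (++-congʳ w q)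
    ++-congʳ w (cons p q r)   = cons p q (++-congʳ w r)
    ++-congʳ w (swap x y)     = swap x y
    ++-congʳ w (merge a a₁ b) = merge a a₁ b
    ++-congʳ w (drop b)       = drop b

    ++-cong : ∀ {u v w z} → u ≋ v → w ≋ z → u ++ w ≋ v ++ z
    ++-cong {v = v} {w} p q = trans (++-congʳ w p) (++-congˡ v q)

    ≡⇒≋ : ∀ {u v} → u ≡ v → u ≋ v
    ≡⇒≋ ≡.refl = refl

    ∷-shift : ∀ x u v → x ∷ (u ++ v) ≋ u ++ x ∷ v
    ∷-shift x []            v = refl
    ∷-shift x ((a , b) ∷ u) v = trans (swap x (a , b)) (cons ≈-refl ≈ᴮ-refl (∷-shift x u v))

    ++-comm : ∀ u v → u ++ v ≋ v ++ u
    ++-comm []            v = ≡⇒≋ (≡.sym (++-identityʳ v))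
    ++-comm ((a , b) ∷ u) v = trans (cons ≈-refl ≈ᴮ-refl (++-comm u v)) (∷-shift (a , b) v u)

    ++-commutativeMonoid : CommutativeMonoid c (c ⊔ ℓ)
    ++-commutativeMonoid = record
      { Carrier = Comb ; _≈_ = _≋_ ; _∙_ = _++_ ; ε = []
      ; isCommutativeMonoid = record
        { isMonoid = record
          { isSemigroup = record
            { isMagma = record
              { isEquivalence = record { refl = refl ; sym = sym ; trans = trans }
              ; ∙-cong = ++-cong }
            ; assoc = λ u v w → ≡⇒≋ (++-assoc u v w) }
          ; identity = (λ u → refl) , (λ u → ≡⇒≋ (++-identityʳ u)) }
        ; comm = ++-comm } }

    open CommutativeMonoid ++-commutativeMonoid public
      using () renaming (setoid to ≋-setoid; commutativeSemigroup to ++-commutativeSemigroup)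
    open CommutativeSemigroupProperties ++-commutativeSemigroup public
      using () renaming (interchange to ++-interchange; x∙yz≈y∙xz to ++-left-comm)

    ·-congˡ : ∀ a {u v} → u ≋ v → a · u ≋ a · v
    ·-congˡ a refl           = refl
    ·-congˡ a (sym p)        = sym (·-congˡ a p)
    ·-congˡ a (trans p q)    = trans (·-congˡ a p) (·-congˡ a q)
    ·-congˡ a (cons p q r)   = cons (*-congˡ p) q (·-congˡ a r)
    ·-congˡ a (swap x y)     = swap _ _
    ·-congˡ a (merge x y b)  = trans (merge _ _ b) (cons (≈-sym (distribˡ a x y)) ≈ᴮ-refl refl)
    ·-congˡ a (drop b)       = trans (cons (zeroʳ a) ≈ᴮ-refl refl) (drop b)

    ·-congʳ : ∀ {a a₁} u → a ≈ a₁ → a · u ≋ a₁ · u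
    ·-congʳ []            p = refl
    ·-congʳ ((x , b) ∷ u) p = cons (*-congʳ p) ≈ᴮ-refl (·-congʳ u p)

    ·-cong : ∀ {a a₁ u v} → a ≈ a₁ → u ≋ v → a · u ≋ a₁ · v
    ·-cong {a₁ = a₁} {u} p q = trans (·-congʳ u p) (·-congˡ a₁ q)

    ·-++ : ∀ a u v → a · (u ++ v) ≡ a · u ++ a · v
    ·-++ a []            v = ≡.refl
    ·-++ a ((x , b) ∷ u) v = ≡.cong (_ ∷_) (·-++ a u v)

    ·-assoc : ∀ a x u → a · x · u ≋ (a * x) · u
    ·-assoc a x []            = refl
    ·-assoc a x ((y , b) ∷ u) = cons (≈-sym (*-assoc a x y)) ≈ᴮ-refl (·-assoc a x u)

    ·-comm : ∀ a x u → a · x · u ≋ x · a · u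
    ·-comm a x u = trans (·-assoc a x u) (trans (·-congʳ u (*-comm a x)) (sym (·-assoc x a u)))

    ·-zero : ∀ u → 0# · u ≋ []
    ·-zero []            = refl
    ·-zero ((x , b) ∷ u) = trans (cons (zeroˡ x) ≈ᴮ-refl refl) (trans (drop b) (·-zero u))

    ·-one : ∀ u → 1# · u ≋ u
    ·-one []            = refl
    ·-one ((x , b) ∷ u) = cons (*-identityˡ x) ≈ᴮ-refl (·-one u)

    ·-distribʳ : ∀ a a₁ u → a · u ++ a₁ · u ≋ (a + a₁) · u
    ·-distribʳ a a₁ []            = refl
    ·-distribʳ a a₁ ((x , b) ∷ u) =
      trans (cons ≈-refl ≈ᴮ-refl (sym (∷-shift _ (a · u) (a₁ · u))))
      (trans (merge _ _ b) (cons (≈-sym (distribʳ x a a₁)) ≈ᴮ-refl (·-distribʳ a a₁ u)))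

  open FreeModule public using (Comb; ≋-setoid)

  -- A linear map out of a free module is given by its values on the basis.

  Functional : Setoid 0ℓ 0ℓ → Set (c ⊔ ℓ)
  Functional B = Func B setoid

  LinearMap : Setoid 0ℓ 0ℓ → Setoid 0ℓ 0ℓ → Set (c ⊔ ℓ)
  LinearMap B C = Func B (≋-setoid C)

  module _ {B : Setoid 0ℓ 0ℓ} where
    open FreeModule B hiding (Comb; ≋-setoid)
    open SetoidReasoning setoid
    open CommutativeSemigroupProperties +-commutativeSemigroup using (x∙yz≈y∙xz)

    infix 9 _⟨_⟩
    _⟨_⟩ : Functional B → Comb B → Carrier
    f ⟨ [] ⟩          = 0#
    f ⟨ (a , b) ∷ u ⟩ = a * Func.to f b + f ⟨ u ⟩

    ⟨⟩-cong : ∀ (f : Functional B) {u v} → u ≋ v → f ⟨ u ⟩ ≈ f ⟨ v ⟩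
    ⟨⟩-cong f refl         = ≈-refl
    ⟨⟩-cong f (sym p)      = ≈-sym (⟨⟩-cong f p)
    ⟨⟩-cong f (trans p q)  = ≈-trans (⟨⟩-cong f p) (⟨⟩-cong f q)
    ⟨⟩-cong f (cons p q r) = +-cong (*-cong p (Func.cong f q)) (⟨⟩-cong f r)
    ⟨⟩-cong f (swap x y)   = x∙yz≈y∙xz _ _ _
    ⟨⟩-cong f (merge a a₁ b) = ≈-trans (≈-sym (+-assoc _ _ _)) (+-congʳ (≈-sym (distribʳ _ a a₁)))
    ⟨⟩-cong f (drop b)     = ≈-trans (+-congʳ (zeroˡ _)) (+-identityˡ _)

  module _ {B C : Setoid 0ℓ 0ℓ} where
    private
      module B = FreeModule B
    open Setoid B using () renaming (Carrier to ∣B∣)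
    open FreeModule C hiding (Comb; ≋-setoid)
    open SetoidReasoning (≋-setoid C)

    -- Linear extension of an arbitrary function on representatives of the basis.
    bind : (∣B∣ → Comb C) → Comb B → Comb C
    bind f []            = []
    bind f ((a , b) ∷ u) = a · f b ++ bind f u

    _⟦_⟧ : LinearMap B C → Comb B → Comb C
    f ⟦ u ⟧ = bind (Func.to f) u

    ⟦⟧-cong : ∀ (f : LinearMap B C) {u v} → u B.≋ v → f ⟦ u ⟧ ≋ f ⟦ v ⟧
    ⟦⟧-cong f B.refl         = refl
    ⟦⟧-cong f (B.sym p)      = sym (⟦⟧-cong f p)
    ⟦⟧-cong f (B.trans p q)  = trans (⟦⟧-cong f p) (⟦⟧-cong f q)
    ⟦⟧-cong f (B.cons p q r) = ++-cong (·-cong p (Func.cong f q)) (⟦⟧-cong f r)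
    ⟦⟧-cong f (B.swap (a , b) (a₁ , b₁) {u}) =
      ++-left-comm (a · Func.to f b) (a₁ · Func.to f b₁) (f ⟦ u ⟧)
    ⟦⟧-cong f (B.merge a a₁ b {u}) =
      trans (≡⇒≋ (≡.sym (++-assoc (a · Func.to f b) (a₁ · Func.to f b) (f ⟦ u ⟧))))
            (++-congʳ (f ⟦ u ⟧) (·-distribʳ a a₁ (Func.to f b)))
    ⟦⟧-cong f (B.drop b)     = ++-congʳ _ (·-zero _)

    bind-congˡ : ∀ {f g} → (∀ b → f b ≋ g b) → ∀ u → bind f u ≋ bind g u
    bind-congˡ p []            = refl
    bind-congˡ p ((a , b) ∷ u) = ++-cong (·-congˡ a (p b)) (bind-congˡ p u)

    bind-++ : ∀ f u v → bind f (u ++ v) ≡ bind f u ++ bind f v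
    bind-++ f []            v = ≡.refl
    bind-++ f ((a , b) ∷ u) v =
      ≡.trans (≡.cong (a · f b ++_) (bind-++ f u v)) (≡.sym (++-assoc (a · f b) _ _))

    bind-· : ∀ f a u → bind f (a B.· u) ≋ a · bind f u
    bind-· f a []            = refl
    bind-· f a ((x , b) ∷ u) =
      trans (++-cong (sym (·-assoc a x (f b))) (bind-· f a u)) (≡⇒≋ (≡.sym (·-++ a (x · f b) _)))

    bind-η : ∀ f b → bind f (B.η b) ≋ f b
    bind-η f b = trans (≡⇒≋ (++-identityʳ _)) (·-one (f b))

    bind-zero : ∀ u → bind (λ _ → []) u ≋ []
    bind-zero []      = refl
    bind-zero (_ ∷ u) = bind-zero u

    bind-sum : ∀ f g u → bind (λ b → f b ++ g b) u ≋ bind f u ++ bind g u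
    bind-sum f g []            = refl
    bind-sum f g ((a , b) ∷ u) = begin
      a · (f b ++ g b) ++ bind (λ x → f x ++ g x) u
        ≈⟨ ++-cong (≡⇒≋ (·-++ a (f b) (g b))) (bind-sum f g u) ⟩
      (a · f b ++ a · g b) ++ (bind f u ++ bind g u)
        ≈⟨ ++-interchange (a · f b) (a · g b) (bind f u) (bind g u) ⟩
      (a · f b ++ bind f u) ++ (a · g b ++ bind g u) ∎

    bind-scale : ∀ f a u → bind (λ b → a · f b) u ≋ a · bind f u
    bind-scale f a []            = refl
    bind-scale f a ((x , b) ∷ u) =
      trans (++-cong (·-comm x a (f b)) (bind-scale f a u)) (≡⇒≋ (≡.sym (·-++ a (x · f b) _)))

  module _ {B C D : Setoid 0ℓ 0ℓ} where
    open Setoid B using () renaming (Carrier to ∣B∣)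
    open Setoid C using () renaming (Carrier to ∣C∣)
    open FreeModule D hiding (Comb; ≋-setoid)

    bind-bind : ∀ (g : ∣C∣ → Comb D) (f : ∣B∣ → Comb C) u →
                bind {C} {D} g (bind {B} {C} f u) ≋ bind {B} {D} (λ b → bind {C} {D} g (f b)) u
    bind-bind g f []            = refl
    bind-bind g f ((a , b) ∷ u) =
      trans (≡⇒≋ (bind-++ {C} {D} g (FreeModule._·_ C a (f b)) _))
            (++-cong (bind-· {C} {D} g a (f b)) (bind-bind g f u))

    bind-swap : ∀ (f : ∣B∣ → ∣C∣ → Comb D) u v →
                bind {B} {D} (λ b → bind {C} {D} (f b) v) u ≋
                bind {C} {D} (λ x → bind {B} {D} (λ b → f b x) u) v
    bind-swap f []            v = sym (bind-zero {C} {D} v)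
    bind-swap f ((a , b) ∷ u) v =
      trans (++-cong (sym (bind-scale {C} {D} (f b) a v)) (bind-swap f u v))
            (sym (bind-sum {C} {D} (λ x → a · f b x) (λ x → bind {B} {D} (λ b₁ → f b₁ x) u) v))

underlyingRing : ∀ {c ℓ₁ ℓ₂} → HeytingField c ℓ₁ ℓ₂ → CommutativeRing c ℓ₁
underlyingRing K = HeytingCommutativeRing.commutativeRing (HeytingField.heytingCommutativeRing K)

-- A classical field is a HeytingField in which x # y is the negation of x ≈ y.
CharacteristicZero : ∀ {c ℓ₁ ℓ₂} → HeytingField c ℓ₁ ℓ₂ → Set ℓ₂
CharacteristicZero K = ∀ n → .{{NonZero n}} → (n ×ₖ 1#) # 0#
  where
  open HeytingField K
  open SemiringDefinitions (RawRing.rawSemiring (CommutativeRing.rawRing (underlyingRing K))) renaming (_×_ to _×ₖ_)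

module Convolution {c ℓ₁ ℓ₂ : Level} (K : HeytingField c ℓ₁ ℓ₂) (char0 : CharacteristicZero K) where

  open HeytingField K using (_#_; #⇒invertible)
  private
    R : CommutativeRing c ℓ₁
    R = underlyingRing K
  open CommutativeRing R renaming (refl to ≈-refl; sym to ≈-sym; trans to ≈-trans)
  open SemiringDefinitions (RawRing.rawSemiring rawRing) public using (_^_) renaming (_×_ to _×ₖ_)
  open RingProperties ring using (-0#≈0#)
  open Linear R public
  open SetoidReasoning setoid

  -- #⇒invertible inverts n·1 - 0#, which equals n·1; see 1/-inverse.
  1/_ : ∀ n → .{{NonZero n}} → Carrier
  1/ n = proj₁ (#⇒invertible (char0 n))

  1/-inverse : ∀ n → .{{_ : NonZero n}} → (1/ n) * (n ×ₖ 1#) ≈ 1#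
  1/-inverse n = ≈-trans (*-congˡ (≈-sym (≈-trans (+-congˡ -0#≈0#) (+-identityʳ _))))
                         (proj₁ (proj₂ (#⇒invertible (char0 n))))

  -- The part of the structure of a connected graded coalgebra that is used to define
  -- convolution powers and logarithms of functionals.
  record ConnectedGraded : Set (Level.suc 0ℓ ⊔ c ⊔ ℓ₁) where
    field
      Basis : Setoid 0ℓ 0ℓ
    open Setoid Basis using () renaming (Carrier to ∣B∣; _≈_ to _≈ᴮ_)
    field
      deg           : ∣B∣ → ℕ
      deg-cong      : ∀ {b b₁} → b ≈ᴮ b₁ → deg b ≡ deg b₁
      𝟏             : ∣B∣
      deg-𝟏         : deg 𝟏 ≡ 0
      connected     : ∀ b → deg b ≡ 0 → b ≈ᴮ 𝟏
      ε             : Functional Basis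
      ε-𝟏           : Func.to ε 𝟏 ≈ 1#
      ε-positive    : ∀ b → 0 < deg b → Func.to ε b ≈ 0#
      Δ             : LinearMap Basis (×-setoid Basis Basis)
      Δ-homogeneous : ∀ b → All (λ (_ , b₁ , b₂) → deg b₁ ℕ.+ deg b₂ ≡ deg b) (Func.to Δ b)

  module Logarithm (C : ConnectedGraded) where
    open ConnectedGraded C
    open Setoid Basis using () renaming (Carrier to ∣B∣; _≈_ to _≈ᴮ_)

    infixl 6 _−_
    _−_ : Functional Basis → Functional Basis → Functional Basis
    f − g = record
      { to   = λ b → Func.to f b - Func.to g b
      ; cong = λ p → +-cong (Func.cong f p) (-‿cong (Func.cong g p)) }

    infix 7 _⊗_
    _⊗_ : Functional Basis → Functional Basis → Functional (×-setoid Basis Basis)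
    f ⊗ g = record
      { to   = λ (b₁ , b₂) → Func.to f b₁ * Func.to g b₂
      ; cong = λ (p , q) → *-cong (Func.cong f p) (Func.cong g q) }

    infixr 7 _∗_
    _∗_ : Functional Basis → Functional Basis → Functional Basis
    f ∗ g = record
      { to   = λ b → (f ⊗ g) ⟨ Func.to Δ b ⟩
      ; cong = λ p → ⟨⟩-cong (f ⊗ g) (Func.cong Δ p) }

    infixr 8 _^∗_
    _^∗_ : Functional Basis → ℕ → Functional Basis
    f ^∗ zero  = ε
    f ^∗ suc n = f ∗ f ^∗ n

    logTerm : Functional Basis → (n : ℕ) → .{{NonZero n}} → ∣B∣ → Carrier
    logTerm χ n b = (- 1#) ^ (n ℕ.+ 1) * (1/ n) * Func.to ((χ − ε) ^∗ n) b

    logPartialSum : Functional Basis → ℕ → ∣B∣ → Carrier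
    logPartialSum χ zero    b = 0#
    logPartialSum χ (suc N) b = logPartialSum χ N b + logTerm χ (suc N) b

    logPartialSum-cong : ∀ χ N {b b₁} → b ≈ᴮ b₁ → logPartialSum χ N b ≈ logPartialSum χ N b₁
    logPartialSum-cong χ zero    p = ≈-refl
    logPartialSum-cong χ (suc N) p =
      +-cong (logPartialSum-cong χ N p) (*-congˡ (Func.cong ((χ − ε) ^∗ suc N) p))

    -- The terms with n > deg b of the logarithm series vanish on b when χ(𝟏) = 1; see
    -- log*-converges.
    log* : Functional Basis → Functional Basis
    log* χ = record
      { to   = λ b → logPartialSum χ (deg b) b
      ; cong = λ {b} {b₁} p →
          ≈-trans (logPartialSum-cong χ (deg b) p)
                  (reflexive (≡.cong (λ N → logPartialSum χ N b₁) (deg-cong p))) }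

    ⟨⟩-vanishes : ∀ {B : Setoid 0ℓ 0ℓ} (f : Functional B) {u} →
                  All (λ (_ , b) → Func.to f b ≈ 0#) u → f ⟨ u ⟩ ≈ 0#
    ⟨⟩-vanishes f []       = ≈-refl
    ⟨⟩-vanishes f (p ∷ ps) =
      ≈-trans (+-cong (≈-trans (*-congˡ p) (zeroʳ _)) (⟨⟩-vanishes f ps)) (+-identityˡ 0#)

    ^∗-vanishes : ∀ f → Func.to f 𝟏 ≈ 0# → ∀ n b → deg b < n → Func.to (f ^∗ n) b ≈ 0#
    ^∗-vanishes f f𝟏 (suc n) b (s≤s b≤n) =
      ⟨⟩-vanishes (f ⊗ f ^∗ n) (All.map (λ {(_ , b₁ , b₂)} → vanish b₁ b₂) (Δ-homogeneous b))
      where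
      vanish : ∀ b₁ b₂ → deg b₁ ℕ.+ deg b₂ ≡ deg b → Func.to f b₁ * Func.to (f ^∗ n) b₂ ≈ 0#
      vanish b₁ b₂ eq with deg b₁ in eq₁
      ... | zero  = ≈-trans (*-congʳ (≈-trans (Func.cong f (connected b₁ eq₁)) f𝟏)) (zeroˡ _)
      ... | suc d = ≈-trans (*-congˡ (^∗-vanishes f f𝟏 n b₂ b₂<n)) (zeroʳ _)
        where
        b₂<n : deg b₂ < n
        b₂<n = ℕ.≤-trans (s≤s (ℕ.m≤n+m (deg b₂) d)) (ℕ.≤-trans (ℕ.≤-reflexive eq) b≤n)

    log*-converges : ∀ χ → Func.to χ 𝟏 ≈ 1# → ∀ b N → deg b ≤ N →
                     logPartialSum χ N b ≈ Func.to (log* χ) b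
    log*-converges χ χ𝟏 b N b≤N = go N (ℕ.≤⇒≤′ b≤N)
      where
      φ𝟏 : Func.to (χ − ε) 𝟏 ≈ 0#
      φ𝟏 = ≈-trans (+-cong χ𝟏 (-‿cong ε-𝟏)) (-‿inverseʳ 1#)
      go : ∀ N → deg b ℕ.≤′ N → logPartialSum χ N b ≈ logPartialSum χ (deg b) b
      go N (ℕ.≤′-reflexive ≡.refl) = ≈-refl
      go (suc N) (ℕ.≤′-step p)     = ≈-trans
        (+-cong (go N p)
          (≈-trans (*-congˡ (^∗-vanishes (χ − ε) φ𝟏 (suc N) b (s≤s (ℕ.≤′⇒≤ p)))) (zeroʳ _)))
        (+-identityʳ _)

-- Rooted trees with vertices labelled in A; the list holds the branches at the root.

data Tree (A : Set) : Set where
  node : A → List (Tree A) → Tree A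

Forest : Set → Set
Forest A = List (Tree A)

infix 4 _≃_ _≃ᶠ_

-- Permuting branches at every vertex is what makes the trees non-planar.
data _≃_ {A : Set} : Rel (Tree A) 0ℓ where
  node : ∀ a {f g} → Permutation _≃_ f g → node a f ≃ node a g

_≃ᶠ_ : {A : Set} → Rel (Forest A) 0ℓ
_≃ᶠ_ = Permutation _≃_

module _ {A : Set} where

  ≃-refl  : ∀ {t : Tree A} → t ≃ t
  ≃ᵖ-refl : ∀ {f : Forest A} → Pointwise _≃_ f f
  ≃-refl {node a f}   = node a (refl ≃ᵖ-refl)
  ≃ᵖ-refl {[]}        = []
  ≃ᵖ-refl {t ∷ f}     = ≃-refl ∷ ≃ᵖ-refl

  ≃-sym   : ∀ {t u : Tree A} → t ≃ u → u ≃ t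
  ≃ᶠ-sym  : ∀ {f g : Forest A} → f ≃ᶠ g → g ≃ᶠ f
  ≃ᵖ-sym  : ∀ {f g : Forest A} → Pointwise _≃_ f g → Pointwise _≃_ g f
  ≃-sym (node a p)     = node a (≃ᶠ-sym p)
  ≃ᶠ-sym (refl p)      = refl (≃ᵖ-sym p)
  ≃ᶠ-sym (prep p q)    = prep (≃-sym p) (≃ᶠ-sym q)
  ≃ᶠ-sym (swap p q r)  = swap (≃-sym q) (≃-sym p) (≃ᶠ-sym r)
  ≃ᶠ-sym (trans p q)   = trans (≃ᶠ-sym q) (≃ᶠ-sym p)
  ≃ᵖ-sym []            = []
  ≃ᵖ-sym (p ∷ q)       = ≃-sym p ∷ ≃ᵖ-sym q

  ≃-trans : ∀ {t u v : Tree A} → t ≃ u → u ≃ v → t ≃ v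
  ≃-trans (node a p) (node .a q) = node a (trans p q)

≃-setoid : Set → Setoid 0ℓ 0ℓ
≃-setoid A = record
  { Carrier = Tree A ; _≈_ = _≃_
  ; isEquivalence = record { refl = ≃-refl ; sym = ≃-sym ; trans = ≃-trans } }

≃ᶠ-setoid : Set → Setoid 0ℓ 0ℓ
≃ᶠ-setoid A = record
  { Carrier = Forest A ; _≈_ = _≃ᶠ_
  ; isEquivalence = record { refl = refl ≃ᵖ-refl ; sym = ≃ᶠ-sym ; trans = trans } }

open PermSetoid (≃-setoid ⊤) using () renaming (++⁺ to ≃ᶠ-++⁺; ++-comm to ≃ᶠ-++-comm; ++-assoc to ≃ᶠ-++-assoc)

RootedForests : Setoid 0ℓ 0ℓ
RootedForests = ≃ᶠ-setoid ⊤

B₊ : Forest ⊤ → Tree ⊤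
B₊ f = node tt f

labelsᵗ : {A : Set} → Tree A → List A
labels  : {A : Set} → Forest A → List A
labelsᵗ (node a f) = a ∷ labels f
labels []          = []
labels (t ∷ f)     = labelsᵗ t ++ labels f

size : {A : Set} → Forest A → ℕ
size f = length (labels f)

labelsᵗ-resp : {A : Set} {t u : Tree A} → t ≃ u → labelsᵗ t ↭ labelsᵗ u
labels-resp  : {A : Set} {f g : Forest A} → f ≃ᶠ g → labels f ↭ labels g
labels-respᵖ : {A : Set} {f g : Forest A} → Pointwise _≃_ f g → labels f ↭ labels g
labelsᵗ-resp (node a p)     = ↭.prep a (labels-resp p)
labels-resp (refl p)        = labels-respᵖ p
labels-resp (prep p q)      = ↭.++⁺ (labelsᵗ-resp p) (labels-resp q)
labels-resp (swap {x = t} {u} {t₁} {u₁} p q r) = ↭.trans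
  (↭.++⁺ (labelsᵗ-resp p) (↭.++⁺ (labelsᵗ-resp q) (labels-resp r)))
  (↭.shifts (labelsᵗ t₁) (labelsᵗ u₁))
labels-resp (trans p q)     = ↭.trans (labels-resp p) (labels-resp q)
labels-respᵖ []             = ↭.refl
labels-respᵖ (p ∷ q)        = ↭.++⁺ (labelsᵗ-resp p) (labels-respᵖ q)

-- A decomposition V ⊔ W of the vertex set of a forest is encoded as a labelling of its
-- vertices by V and W.

data Side : Set where
  V W : Side

_≟_ : (s₁ s₂ : Side) → Dec (s₁ ≡ s₂)
V ≟ V = yes ≡.refl
V ≟ W = no λ ()
W ≟ V = no λ ()
W ≟ W = yes ≡.refl

decompositionsᵗ : Tree ⊤ → List (Tree Side)
decompositions  : Forest ⊤ → List (Forest Side)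
decompositionsᵗ (node _ f) = concatMap (λ d → node V d ∷ node W d ∷ []) (decompositions f)
decompositions []          = [] ∷ []
decompositions (t ∷ f)     = cartesianProductWith _∷_ (decompositionsᵗ t) (decompositions f)

-- The forest induced on the vertices of one side: the parent of a vertex is its nearest
-- ancestor on the same side.
inducedᵗ : Side → Tree Side → Forest ⊤
induced  : Side → Forest Side → Forest ⊤
inducedᵗ s (node s₁ d) = if does (s₁ ≟ s) then B₊ (induced s d) ∷ [] else induced s d
induced s []           = []
induced s (t ∷ d)      = inducedᵗ s t ++ induced s d

-- No vertex of V lies strictly below a vertex of W, where the root of a tree is its lowest
-- vertex: thus W is the part of the forest that contains the roots.
Admissibleᵗ : Tree Side → Set
Admissible  : Forest Side → Set
Admissibleᵗ (node s d) = (s ≡ V → W ∉ labels d) × Admissible d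
Admissible []          = ⊤
Admissible (t ∷ d)     = Admissibleᵗ t × Admissible d

admissibleᵗ? : ∀ t → Dec (Admissibleᵗ t)
admissible?  : ∀ d → Dec (Admissible d)
admissibleᵗ? (node s d) = ((s ≟ V) →-dec ¬? (DecMembership._∈?_ _≟_ W (labels d))) ×-dec admissible? d
admissible? []          = yes tt
admissible? (t ∷ d)     = admissibleᵗ? t ×-dec admissible? d

inducedᵗ-resp : ∀ s {t u} → t ≃ u → inducedᵗ s t ≃ᶠ inducedᵗ s u
induced-resp  : ∀ s {d e} → d ≃ᶠ e → induced s d ≃ᶠ induced s e
induced-respᵖ : ∀ s {d e} → Pointwise _≃_ d e → induced s d ≃ᶠ induced s e
inducedᵗ-resp s (node s₁ p) with s₁ ≟ s
... | yes _ = prep (node tt (induced-resp s p)) (refl [])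
... | no  _ = induced-resp s p
induced-resp s (refl p)      = induced-respᵖ s p
induced-resp s (prep p q)    = ≃ᶠ-++⁺ (inducedᵗ-resp s p) (induced-resp s q)
induced-resp s (swap {d} {e} {t} {u} {t₁} {u₁} p q r) = trans
  (≃ᶠ-++⁺ (inducedᵗ-resp s p) (≃ᶠ-++⁺ (inducedᵗ-resp s q) (induced-resp s r)))
  (trans (≃ᶠ-sym (≃ᶠ-++-assoc (inducedᵗ s t₁) (inducedᵗ s u₁) (induced s e)))
  (trans (≃ᶠ-++⁺ (≃ᶠ-++-comm (inducedᵗ s t₁) (inducedᵗ s u₁)) (refl ≃ᵖ-refl))
         (≃ᶠ-++-assoc (inducedᵗ s u₁) (inducedᵗ s t₁) (induced s e))))
induced-resp s (trans p q)   = trans (induced-resp s p) (induced-resp s q)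
induced-respᵖ s []           = refl []
induced-respᵖ s (p ∷ q)      = ≃ᶠ-++⁺ (inducedᵗ-resp s p) (induced-respᵖ s q)

admissibleᵗ-resp : ∀ {t u} → t ≃ u → Admissibleᵗ t → Admissibleᵗ u
admissible-resp  : ∀ {d e} → d ≃ᶠ e → Admissible d → Admissible e
admissible-respᵖ : ∀ {d e} → Pointwise _≃_ d e → Admissible d → Admissible e
admissibleᵗ-resp (node s p) (a , b) =
  (λ s≡V W∈e → a s≡V (↭.∈-resp-↭ (↭.↭-sym (labels-resp p)) W∈e)) , admissible-resp p b
admissible-resp (refl p) a               = admissible-respᵖ p a
admissible-resp (prep p q) (a , b)       = admissibleᵗ-resp p a , admissible-resp q b
admissible-resp (swap p q r) (a , b , d) = admissibleᵗ-resp q b , admissibleᵗ-resp p a , admissible-resp r d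
admissible-resp (trans p q) a            = admissible-resp q (admissible-resp p a)
admissible-respᵖ [] a                    = a
admissible-respᵖ (p ∷ q) (a , b)         = admissibleᵗ-resp p a , admissible-respᵖ q b

size-++ : {A : Set} (f g : Forest A) → size (f ++ g) ≡ size f ℕ.+ size g
size-++ []      g = ≡.refl
size-++ (t ∷ f) g = ≡.trans (length-++ (labelsᵗ t)) (≡.trans (≡.cong (length (labelsᵗ t) ℕ.+_) (size-++ f g))
  (≡.trans (≡.sym (ℕ.+-assoc (length (labelsᵗ t)) _ _)) (≡.cong (ℕ._+ size g) (≡.sym (length-++ (labelsᵗ t))))))

induced-sizeᵗ : ∀ t → size (inducedᵗ V t) ℕ.+ size (inducedᵗ W t) ≡ length (labelsᵗ t)
induced-size  : ∀ d → size (induced V d) ℕ.+ size (induced W d) ≡ size d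
induced-sizeᵗ (node V d) = ≡.cong suc (≡.trans
  (≡.cong (λ l → length l ℕ.+ size (induced W d)) (++-identityʳ (labels (induced V d)))) (induced-size d))
induced-sizeᵗ (node W d) = ≡.trans (ℕ.+-suc (size (induced V d)) _) (≡.cong suc (≡.trans
  (≡.cong (λ l → size (induced V d) ℕ.+ length l) (++-identityʳ (labels (induced W d)))) (induced-size d)))
induced-size []          = ≡.refl
induced-size (t ∷ d)     = ≡.trans
  (≡.cong₂ ℕ._+_ (size-++ (inducedᵗ V t) (induced V d)) (size-++ (inducedᵗ W t) (induced W d)))
  (≡.trans (ℕ-interchange (size (inducedᵗ V t)) (size (induced V d)) (size (inducedᵗ W t)) (size (induced W d)))
  (≡.trans (≡.cong₂ ℕ._+_ (induced-sizeᵗ t) (induced-size d)) (≡.sym (length-++ (labelsᵗ t)))))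
  where open CommutativeSemigroupProperties ℕ.+-commutativeSemigroup
          using () renaming (interchange to ℕ-interchange)

decompositions-sizeᵗ : ∀ t → All (λ u → length (labelsᵗ u) ≡ length (labelsᵗ t)) (decompositionsᵗ t)
decompositions-size  : ∀ f → All (λ d → size d ≡ size f) (decompositions f)
decompositions-sizeᵗ (node tt f) = All.concat⁺ (All.map⁺ (All.map
  (λ p → ≡.cong suc p ∷ ≡.cong suc p ∷ []) (decompositions-size f)))
decompositions-size []      = ≡.refl ∷ []
decompositions-size (t ∷ f) = go (decompositions-sizeᵗ t)
  where
  go : ∀ {us} → All (λ u → length (labelsᵗ u) ≡ length (labelsᵗ t)) us →
       All (λ d → size d ≡ size (t ∷ f)) (cartesianProductWith _∷_ us (decompositions f))
  go []                = []
  go (_∷_ {u} p ps) = All.++⁺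
    (All.map⁺ (All.map (λ q → ≡.trans (length-++ (labelsᵗ u))
      (≡.trans (≡.cong₂ ℕ._+_ p q) (≡.sym (length-++ (labelsᵗ t))))) (decompositions-size f)))
    (go ps)

module HopfAlgebras {c ℓ₁ ℓ₂ : Level} (K : HeytingField c ℓ₁ ℓ₂) (char0 : CharacteristicZero K) where

  private
    R : CommutativeRing c ℓ₁
    R = underlyingRing K
  open CommutativeRing R renaming (refl to ≈-refl; sym to ≈-sym; trans to ≈-trans)
  open Convolution K char0 public

  -- 𝒜 = k[x], with basis xⁿ ↔ n ∈ ℕ.

  module QuasiShuffle where

    open FreeModule (≡.setoid ℕ) hiding (Comb; ≋-setoid) public
    open CommutativeMonoidSolver ++-commutativeMonoid using (solve; _⊕_; _⊜_)

    𝒜 : Set c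
    𝒜 = Comb (≡.setoid ℕ)

    x^_ : ℕ → 𝒜
    x^ n = η n

    infixl 8 _·x
    _·x : 𝒜 → 𝒜
    u ·x = map (map₂ suc) u

    infixl 7 _⋄ᵇ_ _⋄_
    _⋄ᵇ_ : ℕ → ℕ → 𝒜
    zero  ⋄ᵇ l     = x^ l
    suc k ⋄ᵇ zero  = x^ suc k
    suc k ⋄ᵇ suc l = (k ⋄ᵇ suc l) ·x ++ (suc k ⋄ᵇ l) ·x ++ (k ⋄ᵇ l) ·x

    extend : (ℕ → 𝒜) → 𝒜 → 𝒜
    extend = bind {≡.setoid ℕ} {≡.setoid ℕ}

    _⋄_ : 𝒜 → 𝒜 → 𝒜
    u ⋄ v = extend (λ k → extend (λ l → k ⋄ᵇ l) v) u

    extend-cong : ∀ f {u v} → u ≋ v → extend f u ≋ extend f v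
    extend-cong f = ⟦⟧-cong (record { to = f ; cong = λ { ≡.refl → refl } })

    extend-congˡ : ∀ {f g} → (∀ n → f n ≋ g n) → ∀ u → extend f u ≋ extend g u
    extend-congˡ = bind-congˡ {≡.setoid ℕ} {≡.setoid ℕ}

    extend-η : ∀ f n → extend f (η n) ≋ f n
    extend-η = bind-η {≡.setoid ℕ} {≡.setoid ℕ}

    η-extend : ∀ u → extend η u ≋ u
    η-extend []            = refl
    η-extend ((a , n) ∷ u) = cons (*-identityʳ a) ≡.refl (η-extend u)

    ·x-cong : ∀ {u v} → u ≋ v → u ·x ≋ v ·x
    ·x-cong refl           = refl
    ·x-cong (sym p)        = sym (·x-cong p)
    ·x-cong (trans p q)    = trans (·x-cong p) (·x-cong q)
    ·x-cong (cons p q r)   = cons p (≡.cong suc q) (·x-cong r)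
    ·x-cong (swap x y)     = swap _ _
    ·x-cong (merge a b n)  = merge a b (suc n)
    ·x-cong (drop n)       = drop (suc n)

    ·x-++ : ∀ u v → (u ++ v) ·x ≡ u ·x ++ v ·x
    ·x-++ = map-++ (map₂ suc)

    ·x-· : ∀ a u → (a · u) ·x ≡ a · u ·x
    ·x-· a []      = ≡.refl
    ·x-· a (_ ∷ u) = ≡.cong (_ ∷_) (·x-· a u)

    extend-·x : ∀ f u → extend f (u ·x) ≡ extend (λ n → f (suc n)) u
    extend-·x f []            = ≡.refl
    extend-·x f ((a , n) ∷ u) = ≡.cong (a · f (suc n) ++_) (extend-·x f u)

    ·x-extend : ∀ f u → extend (λ n → f n ·x) u ≡ extend f u ·x
    ·x-extend f []            = ≡.refl
    ·x-extend f ((a , n) ∷ u) =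
      ≡.trans (≡.cong₂ _++_ (≡.sym (·x-· a (f n))) (·x-extend f u)) (≡.sym (·x-++ (a · f n) _))

    extend-++₃ : ∀ f u v w → extend f (u ++ v ++ w) ≡ extend f u ++ extend f v ++ extend f w
    extend-++₃ f u v w = ≡.trans (bind-++ {≡.setoid ℕ} {≡.setoid ℕ} f u (v ++ w))
      (≡.cong (extend f u ++_) (bind-++ {≡.setoid ℕ} {≡.setoid ℕ} f v w))

    ⋄ᵇ-comm : ∀ k l → k ⋄ᵇ l ≋ l ⋄ᵇ k
    ⋄ᵇ-comm zero    zero    = refl
    ⋄ᵇ-comm zero    (suc l) = refl
    ⋄ᵇ-comm (suc k) zero    = refl
    ⋄ᵇ-comm (suc k) (suc l) = trans
      (++-cong (·x-cong (⋄ᵇ-comm k (suc l)))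
        (++-cong (·x-cong (⋄ᵇ-comm (suc k) l)) (·x-cong (⋄ᵇ-comm k l))))
      (++-left-comm ((suc l ⋄ᵇ k) ·x) ((l ⋄ᵇ suc k) ·x) ((l ⋄ᵇ k) ·x))

    ⋄ᵇ-identityʳ : ∀ k → k ⋄ᵇ 0 ≋ x^ k
    ⋄ᵇ-identityʳ zero    = refl
    ⋄ᵇ-identityʳ (suc k) = refl

    private
      L : ℕ → 𝒜 → 𝒜
      L k u = extend (λ l → k ⋄ᵇ l) u

      Rt : ℕ → 𝒜 → 𝒜
      Rt l u = extend (λ k → k ⋄ᵇ l) u

    extend-sum₃ : ∀ f g h u → extend (λ n → f n ·x ++ g n ·x ++ h n ·x) u ≋
                  extend f u ·x ++ extend g u ·x ++ extend h u ·x
    extend-sum₃ f g h u = trans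
      (bind-sum {≡.setoid ℕ} {≡.setoid ℕ} (λ n → f n ·x) (λ n → g n ·x ++ h n ·x) u)
      (++-cong (≡⇒≋ (·x-extend f u))
        (trans (bind-sum {≡.setoid ℕ} {≡.setoid ℕ} (λ n → g n ·x) (λ n → h n ·x) u)
               (++-cong (≡⇒≋ (·x-extend g u)) (≡⇒≋ (·x-extend h u)))))

    Rt-suc : ∀ m u → Rt (suc m) (u ·x) ≋ Rt (suc m) u ·x ++ Rt m (u ·x) ·x ++ Rt m u ·x
    Rt-suc m u = trans (≡⇒≋ (extend-·x (_⋄ᵇ suc m) u))
      (trans (extend-sum₃ (_⋄ᵇ suc m) (λ k → suc k ⋄ᵇ m) (_⋄ᵇ m) u)
             (++-congˡ (Rt (suc m) u ·x)
               (++-congʳ (Rt m u ·x) (≡⇒≋ (≡.cong _·x (≡.sym (extend-·x (_⋄ᵇ m) u)))))))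

    L-suc : ∀ k u → L (suc k) (u ·x) ≋ L k (u ·x) ·x ++ L (suc k) u ·x ++ L k u ·x
    L-suc k u = trans (≡⇒≋ (extend-·x (suc k ⋄ᵇ_) u))
      (trans (extend-sum₃ (λ l → k ⋄ᵇ suc l) (suc k ⋄ᵇ_) (k ⋄ᵇ_) u)
             (++-congʳ _ (≡⇒≋ (≡.cong _·x (≡.sym (extend-·x (k ⋄ᵇ_) u))))))

    ⋄ᵇ-assoc : ∀ k l m → Rt m (k ⋄ᵇ l) ≋ L k (l ⋄ᵇ m)
    ⋄ᵇ-assoc zero l m = trans (extend-η (_⋄ᵇ m) l) (sym (η-extend (l ⋄ᵇ m)))
    ⋄ᵇ-assoc (suc k) zero m = trans (extend-η (_⋄ᵇ m) (suc k)) (sym (extend-η (suc k ⋄ᵇ_) m))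
    ⋄ᵇ-assoc (suc k) (suc l) zero = trans
      (trans (extend-congˡ ⋄ᵇ-identityʳ (suc k ⋄ᵇ suc l)) (η-extend (suc k ⋄ᵇ suc l)))
      (sym (extend-η (suc k ⋄ᵇ_) (suc l)))
    ⋄ᵇ-assoc (suc k) (suc l) (suc m) =
      trans (expandˡ (k ⋄ᵇ suc l) (suc k ⋄ᵇ l) (k ⋄ᵇ l))
      (trans (regroup
        (⋄ᵇ-assoc k (suc l) (suc m)) (⋄ᵇ-assoc (suc k) l (suc m)) (⋄ᵇ-assoc k l (suc m))
        (⋄ᵇ-assoc (suc k) (suc l) m)
        (⋄ᵇ-assoc k (suc l) m) (⋄ᵇ-assoc (suc k) l m) (⋄ᵇ-assoc k l m))
      (sym (expandʳ (l ⋄ᵇ suc m) (suc l ⋄ᵇ m) (l ⋄ᵇ m))))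
      where
      split₃ : ∀ f u v w → extend f (u ++ v ++ w) ·x ≋ extend f u ·x ++ extend f v ·x ++ extend f w ·x
      split₃ f u v w = ≡⇒≋ (≡.trans (≡.cong _·x (extend-++₃ f u v w))
        (≡.trans (·x-++ (extend f u) _) (≡.cong (extend f u ·x ++_) (·x-++ (extend f v) _))))

      join₃ : ∀ u v w → u ·x ++ v ·x ++ w ·x ≡ (u ++ v ++ w) ·x
      join₃ u v w = ≡.sym (≡.trans (·x-++ u (v ++ w)) (≡.cong (u ·x ++_) (·x-++ v w)))

      expandˡ : ∀ p q r → Rt (suc m) (p ·x ++ q ·x ++ r ·x) ≋
        (Rt (suc m) p ·x ++ Rt (suc m) q ·x ++ Rt (suc m) r ·x) ++
        Rt m (p ·x ++ q ·x ++ r ·x) ·x ++ (Rt m p ·x ++ Rt m q ·x ++ Rt m r ·x)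
      expandˡ p q r rewrite join₃ p q r = trans (Rt-suc m (p ++ q ++ r))
        (++-cong (split₃ (_⋄ᵇ suc m) p q r)
          (++-congˡ (Rt m ((p ++ q ++ r) ·x) ·x) (split₃ (_⋄ᵇ m) p q r)))

      expandʳ : ∀ p q r → L (suc k) (p ·x ++ q ·x ++ r ·x) ≋
        L k (p ·x ++ q ·x ++ r ·x) ·x ++ (L (suc k) p ·x ++ L (suc k) q ·x ++ L (suc k) r ·x) ++
        (L k p ·x ++ L k q ·x ++ L k r ·x)
      expandʳ p q r rewrite join₃ p q r = trans (L-suc k (p ++ q ++ r))
        (++-congˡ (L k ((p ++ q ++ r) ·x) ·x)
          (++-cong (split₃ (suc k ⋄ᵇ_) p q r) (split₃ (k ⋄ᵇ_) p q r)))

      regroup : ∀ {a b d e f g h a₁ b₁ d₁ e₁ f₁ g₁ h₁} →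
        a ≋ a₁ → b ≋ b₁ → d ≋ d₁ → e ≋ e₁ → f ≋ f₁ → g ≋ g₁ → h ≋ h₁ →
        (a ·x ++ b ·x ++ d ·x) ++ e ·x ++ (f ·x ++ g ·x ++ h ·x) ≋
        a₁ ·x ++ (b₁ ·x ++ e₁ ·x ++ g₁ ·x) ++ (d₁ ·x ++ f₁ ·x ++ h₁ ·x)
      regroup {a₁ = a₁} {b₁} {d₁} {e₁} {f₁} {g₁} {h₁} pa pb pd pe pf pg ph = trans
        (++-cong (++-cong (·x-cong pa) (++-cong (·x-cong pb) (·x-cong pd)))
          (++-cong (·x-cong pe) (++-cong (·x-cong pf) (++-cong (·x-cong pg) (·x-cong ph)))))
        (solve 7 (λ a b d e f g h →
            (a ⊕ (b ⊕ d)) ⊕ (e ⊕ (f ⊕ (g ⊕ h))) ⊜ a ⊕ ((b ⊕ (e ⊕ g)) ⊕ (d ⊕ (f ⊕ h))))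
          refl (a₁ ·x) (b₁ ·x) (d₁ ·x) (e₁ ·x) (f₁ ·x) (g₁ ·x) (h₁ ·x))

    ⋄-cong : ∀ {u u₁ v v₁} → u ≋ u₁ → v ≋ v₁ → u ⋄ v ≋ u₁ ⋄ v₁
    ⋄-cong {u₁ = u₁} {v} p q = trans (extend-cong (λ k → L k v) p)
      (extend-congˡ (λ k → extend-cong (k ⋄ᵇ_) q) u₁)

    ⋄-comm : ∀ u v → u ⋄ v ≋ v ⋄ u
    ⋄-comm u v = trans (bind-swap {≡.setoid ℕ} {≡.setoid ℕ} {≡.setoid ℕ} _⋄ᵇ_ u v)
      (extend-congˡ (λ l → extend-congˡ (λ k → ⋄ᵇ-comm k l) u) v)

    ⋄-assoc : ∀ u v w → (u ⋄ v) ⋄ w ≋ u ⋄ (v ⋄ w)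
    ⋄-assoc u v w = trans (bb (λ k → L k w) (λ i → L i v) u) (extend-congˡ (λ i →
      trans (bb (λ k → L k w) (i ⋄ᵇ_) v)
      (trans (extend-congˡ (λ j →
        trans (bind-swap {≡.setoid ℕ} {≡.setoid ℕ} {≡.setoid ℕ} _⋄ᵇ_ (i ⋄ᵇ j) w)
        (trans (extend-congˡ (λ m → ⋄ᵇ-assoc i j m) w) (sym (bb (i ⋄ᵇ_) (j ⋄ᵇ_) w)))) v)
      (sym (bb (i ⋄ᵇ_) (λ j → L j w) v)))) u)
      where
      bb : ∀ g f u → extend g (extend f u) ≋ extend (λ n → extend g (f n)) u
      bb = bind-bind {≡.setoid ℕ} {≡.setoid ℕ} {≡.setoid ℕ}

    ⋄-left-comm : ∀ u v w → u ⋄ (v ⋄ w) ≋ v ⋄ (u ⋄ w)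
    ⋄-left-comm u v w = trans (sym (⋄-assoc u v w))
      (trans (⋄-cong {v = w} {v₁ = w} (⋄-comm u v) refl) (⋄-assoc v u w))

    -- Δ(xⁿ) = Σ_{r=0}^n x^r ⊗ x^(n-r)
    deconcatenation : ℕ → Comb (×-setoid (≡.setoid ℕ) (≡.setoid ℕ))
    deconcatenation n = map (λ r → (1# , r , n ℕ.∸ r)) (upTo (suc n))

    ε𝒜 : Functional (≡.setoid ℕ)
    ε𝒜 = record { to = λ { zero → 1# ; (suc n) → 0# } ; cong = λ { ≡.refl → ≈-refl } }

    𝒜-graded : ConnectedGraded
    𝒜-graded = record
      { Basis         = ≡.setoid ℕ
      ; deg           = λ n → n
      ; deg-cong      = λ p → p
      ; 𝟏             = 0
      ; deg-𝟏         = ≡.refl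
      ; connected     = λ n p → p
      ; ε             = ε𝒜
      ; ε-𝟏           = ≈-refl
      ; ε-positive    = λ { (suc n) p → ≈-refl }
      ; Δ             = record
        { to   = deconcatenation
        ; cong = λ { ≡.refl → FreeModule.refl } }
      ; Δ-homogeneous = λ n → All.map⁺
          (All.applyUpTo⁺₁ (λ r → r) (suc n) (λ { (s≤s r≤n) → ℕ.m+[n∸m]≡n r≤n }))
      }

    δ̃ : Functional (≡.setoid ℕ)
    δ̃ = record
      { to   = λ { 0 → 1# ; 1 → 1# ; (suc (suc s)) → 0# }
      ; cong = λ { ≡.refl → ≈-refl } }

  module ConnesKreimer where

    open QuasiShuffle using (𝒜; x^_; _·x; _⋄_)
    private
      module 𝒜 = QuasiShuffle

    ℋ : Set c
    ℋ = Comb RootedForests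

    ForestPairs : Setoid 0ℓ 0ℓ
    ForestPairs = ×-setoid RootedForests RootedForests

    open FreeModule ForestPairs hiding (Comb; ≋-setoid)

    -- Since filter keeps multiplicities, coproduct sums over decompositions of the vertex set
    -- and not over isomorphism classes of pairs.
    cut : Forest Side → Carrier × Forest ⊤ × Forest ⊤
    cut d = 1# , induced V d , induced W d

    coproduct : Forest ⊤ → Comb ForestPairs
    coproduct f = map cut (filter admissible? (decompositions f))

    -- The rest, up to coproduct-resp, shows that coproduct respects isomorphism of forests.

    Σ[_] : {X : Set} → List X → (X → Comb ForestPairs) → Comb ForestPairs
    Σ[ [] ]     F = []
    Σ[ x ∷ xs ] F = F x ++ Σ[ xs ] F

    module _ {X : Set} where

      Σ-cong : ∀ (xs : List X) {F G} → (∀ x → F x ≋ G x) → Σ[ xs ] F ≋ Σ[ xs ] G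
      Σ-cong []       p = refl
      Σ-cong (x ∷ xs) p = ++-cong (p x) (Σ-cong xs p)

      Σ-++ : ∀ (xs ys : List X) F → Σ[ xs ++ ys ] F ≡ Σ[ xs ] F ++ Σ[ ys ] F
      Σ-++ []       ys F = ≡.refl
      Σ-++ (x ∷ xs) ys F = ≡.trans (≡.cong (F x ++_) (Σ-++ xs ys F)) (≡.sym (++-assoc (F x) _ _))

      Σ-[] : ∀ (xs : List X) → Σ[ xs ] (λ _ → []) ≡ []
      Σ-[] []       = ≡.refl
      Σ-[] (_ ∷ xs) = Σ-[] xs

      Σ-∙ : ∀ (xs : List X) F G → Σ[ xs ] (λ x → F x ++ G x) ≋ Σ[ xs ] F ++ Σ[ xs ] G
      Σ-∙ []       F G = refl
      Σ-∙ (x ∷ xs) F G = trans (++-congˡ (F x ++ G x) (Σ-∙ xs F G))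
        (++-interchange (F x) (G x) (Σ[ xs ] F) (Σ[ xs ] G))

    module _ {X Y : Set} where

      Σ-swap : ∀ (xs : List X) (ys : List Y) (F : X → Y → Comb ForestPairs) →
               Σ[ xs ] (λ x → Σ[ ys ] (λ y → F x y)) ≋ Σ[ ys ] (λ y → Σ[ xs ] (λ x → F x y))
      Σ-swap []       ys F = ≡⇒≋ (≡.sym (Σ-[] ys))
      Σ-swap (x ∷ xs) ys F = trans (++-congˡ (Σ[ ys ] (F x)) (Σ-swap xs ys F))
        (sym (Σ-∙ ys (F x) (λ y → Σ[ xs ] (λ x₁ → F x₁ y))))

      Σ-map : ∀ (g : X → Y) xs F → Σ[ map g xs ] F ≡ Σ[ xs ] (F ∘ g)
      Σ-map g []       F = ≡.refl
      Σ-map g (x ∷ xs) F = ≡.cong (F (g x) ++_) (Σ-map g xs F)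

      Σ-concatMap : ∀ (g : X → List Y) xs F → Σ[ concatMap g xs ] F ≡ Σ[ xs ] (λ x → Σ[ g x ] F)
      Σ-concatMap g []       F = ≡.refl
      Σ-concatMap g (x ∷ xs) F = ≡.trans (Σ-++ (g x) (concatMap g xs) F)
        (≡.cong (Σ[ g x ] F ++_) (Σ-concatMap g xs F))

      Σ-cartesian : ∀ {Z : Set} (g : X → Y → Z) xs ys F →
                    Σ[ cartesianProductWith g xs ys ] F ≡ Σ[ xs ] (λ x → Σ[ ys ] (λ y → F (g x y)))
      Σ-cartesian g []       ys F = ≡.refl
      Σ-cartesian g (x ∷ xs) ys F = ≡.trans (Σ-++ (map (g x) ys) _ F)
        (≡.cong₂ _++_ (Σ-mapᶻ ys) (Σ-cartesian g xs ys F))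
        where
        Σ-mapᶻ : ∀ ys → Σ[ map (g x) ys ] F ≡ Σ[ ys ] (λ y → F (g x y))
        Σ-mapᶻ []       = ≡.refl
        Σ-mapᶻ (y ∷ ys) = ≡.cong (F (g x y) ++_) (Σ-mapᶻ ys)

    Σ-∷ : ∀ t f F → Σ[ decompositions (t ∷ f) ] F ≋
          Σ[ decompositionsᵗ t ] (λ a → Σ[ decompositions f ] (λ d → F (a ∷ d)))
    Σ-∷ t f F = ≡⇒≋ (Σ-cartesian _∷_ (decompositionsᵗ t) (decompositions f) F)

    Respectsᵗ : (Tree Side → Comb ForestPairs) → Set (c ⊔ ℓ₁)
    Respectsᵗ F = ∀ {t u} → t ≃ u → F t ≋ F u

    Respects : (Forest Side → Comb ForestPairs) → Set (c ⊔ ℓ₁)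
    Respects F = ∀ {d e} → d ≃ᶠ e → F d ≋ F e

    Σ-respᵗ : ∀ {t u} → t ≃ u → ∀ F → Respectsᵗ F → Σ[ decompositionsᵗ t ] F ≋ Σ[ decompositionsᵗ u ] F
    Σ-resp  : ∀ {f g} → f ≃ᶠ g → ∀ F → Respects F → Σ[ decompositions f ] F ≋ Σ[ decompositions g ] F
    Σ-respᵖ : ∀ {f g} → Pointwise _≃_ f g → ∀ F → Respects F → Σ[ decompositions f ] F ≋ Σ[ decompositions g ] F
    Σ-respᵗ (node tt {f} {g} p) F r = trans (≡⇒≋ (Σ-concatMap _ (decompositions f) F))
      (trans (Σ-resp p (λ d → F (node V d) ++ F (node W d) ++ [])
                (λ q → ++-cong (r (node V q)) (++-congʳ [] (r (node W q)))))
             (≡⇒≋ (≡.sym (Σ-concatMap _ (decompositions g) F))))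
    Σ-resp (refl p) F r = Σ-respᵖ p F r
    Σ-resp (prep {f} {g} {t} {u} p q) F r = trans (Σ-∷ t f F)
      (trans (Σ-cong (decompositionsᵗ t) (λ a → Σ-resp q (λ d → F (a ∷ d)) (λ s → r (prep ≃-refl s))))
      (trans (Σ-respᵗ p (λ a → Σ[ decompositions g ] (λ d → F (a ∷ d)))
                (λ s → Σ-cong (decompositions g) (λ d → r (prep s (refl ≃ᵖ-refl)))))
             (sym (Σ-∷ u g F))))
    Σ-resp (swap {f} {g} {t} {u} {t₁} {u₁} p q o) F r = trans (expand t u f F)
      (trans (Σ-cong (decompositionsᵗ t) (λ a → Σ-cong (decompositionsᵗ u) (λ b →
                Σ-resp o (λ d → F (a ∷ b ∷ d)) (λ s → r (prep ≃-refl (prep ≃-refl s))))))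
      (trans (Σ-cong (decompositionsᵗ t) (λ a →
                Σ-respᵗ q (λ b → Σ[ decompositions g ] (λ d → F (a ∷ b ∷ d)))
                  (λ s → Σ-cong (decompositions g) (λ d → r (prep ≃-refl (prep s (refl ≃ᵖ-refl)))))))
      (trans (Σ-respᵗ p (λ a → Σ[ decompositionsᵗ u₁ ] (λ b → Σ[ decompositions g ] (λ d → F (a ∷ b ∷ d))))
                (λ s → Σ-cong (decompositionsᵗ u₁) (λ b → Σ-cong (decompositions g) (λ d →
                  r (prep s (refl ≃ᵖ-refl))))))
      (trans (Σ-swap (decompositionsᵗ t₁) (decompositionsᵗ u₁) (λ a b → Σ[ decompositions g ] (λ d → F (a ∷ b ∷ d))))
      (trans (Σ-cong (decompositionsᵗ u₁) (λ b → Σ-cong (decompositionsᵗ t₁) (λ a →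
                Σ-cong (decompositions g) (λ d → r (swap ≃-refl ≃-refl (refl ≃ᵖ-refl))))))
             (sym (expand u₁ t₁ g F)))))))
      where
      expand : ∀ t u f F → Σ[ decompositions (t ∷ u ∷ f) ] F ≋
               Σ[ decompositionsᵗ t ] (λ a → Σ[ decompositionsᵗ u ] (λ b →
                 Σ[ decompositions f ] (λ d → F (a ∷ b ∷ d))))
      expand t u f F = trans (Σ-∷ t (u ∷ f) F)
        (Σ-cong (decompositionsᵗ t) (λ a → Σ-∷ u f (λ d → F (a ∷ d))))
    Σ-resp (trans p q) F r = trans (Σ-resp p F r) (Σ-resp q F r)
    Σ-respᵖ [] F r = refl
    Σ-respᵖ (_∷_ {t} {u} {f} {g} p q) F r = trans (Σ-∷ t f F)
      (trans (Σ-cong (decompositionsᵗ t) (λ a → Σ-respᵖ q (λ d → F (a ∷ d)) (λ s → r (prep ≃-refl s))))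
      (trans (Σ-respᵗ p (λ a → Σ[ decompositions g ] (λ d → F (a ∷ d)))
                (λ s → Σ-cong (decompositions g) (λ d → r (prep s (refl ≃ᵖ-refl)))))
             (sym (Σ-∷ u g F))))

    summand : Forest Side → Comb ForestPairs
    summand d with admissible? d
    ... | yes _ = cut d ∷ []
    ... | no  _ = []

    summand-resp : Respects summand
    summand-resp {d} {e} p with admissible? d | admissible? e
    ... | yes _ | yes _ = cons ≈-refl (induced-resp V p , induced-resp W p) refl
    ... | no  _ | no  _ = refl
    ... | yes a | no  b = ⊥-elim (b (admissible-resp p a))
    ... | no  a | yes b = ⊥-elim (a (admissible-resp (≃ᶠ-sym p) b))

    coproduct-Σ : ∀ ds → map cut (filter admissible? ds) ≡ Σ[ ds ] summand
    coproduct-Σ []       = ≡.refl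
    coproduct-Σ (d ∷ ds) with admissible? d
    ... | yes _ = ≡.cong (cut d ∷_) (coproduct-Σ ds)
    ... | no  _ = coproduct-Σ ds

    coproduct-resp : ∀ {f g} → f ≃ᶠ g → coproduct f ≋ coproduct g
    coproduct-resp {f} {g} p = trans (≡⇒≋ (coproduct-Σ (decompositions f)))
      (trans (Σ-resp p summand summand-resp) (≡⇒≋ (≡.sym (coproduct-Σ (decompositions g)))))

    coproduct-homogeneous : ∀ f → All (λ (_ , v , w) → size v ℕ.+ size w ≡ size f) (coproduct f)
    coproduct-homogeneous f = All.map⁺ (All.filter⁺ admissible?
      (All.map (λ {d} p → ≡.trans (induced-size d) p) (decompositions-size f)))

    εℋ : Functional RootedForests
    εℋ = record { to = ε ; cong = ε-cong }
      where
      ε : Forest ⊤ → Carrier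
      ε []      = 1#
      ε (_ ∷ _) = 0#
      ε-cong : ∀ {f g} → f ≃ᶠ g → ε f ≈ ε g
      ε-cong (refl [])      = ≈-refl
      ε-cong (refl (_ ∷ _)) = ≈-refl
      ε-cong (prep _ _)     = ≈-refl
      ε-cong (swap _ _ _)   = ≈-refl
      ε-cong (trans p q)    = ≈-trans (ε-cong p) (ε-cong q)

    ℋ-graded : ConnectedGraded
    ℋ-graded = record
      { Basis         = RootedForests
      ; deg           = size
      ; deg-cong      = λ p → ↭.↭-length (labels-resp p)
      ; 𝟏             = []
      ; deg-𝟏         = ≡.refl
      ; connected     = λ { [] _ → refl [] ; (node _ _ ∷ _) () }
      ; ε             = εℋ
      ; ε-𝟏           = ≈-refl
      ; ε-positive    = λ { (_ ∷ _) _ → ≈-refl }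
      ; Δ             = record { to = coproduct ; cong = coproduct-resp }
      ; Δ-homogeneous = coproduct-homogeneous
      }

    -- On monomials, the unital algebra morphism with Λ(B₊(t₁⋯tₙ)) = (Λ(t₁) ⋄ ⋯ ⋄ Λ(tₙ)) x.
    Λᵗ : Tree ⊤ → 𝒜
    Λᶠ : Forest ⊤ → 𝒜
    Λᵗ (node _ f) = Λᶠ f ·x
    Λᶠ []         = x^ 0
    Λᶠ (t ∷ f)    = Λᵗ t ⋄ Λᶠ f

    Λᵗ-resp : ∀ {t u} → t ≃ u → Λᵗ t 𝒜.≋ Λᵗ u
    Λᶠ-resp : ∀ {f g} → f ≃ᶠ g → Λᶠ f 𝒜.≋ Λᶠ g
    Λᶠ-respᵖ : ∀ {f g} → Pointwise _≃_ f g → Λᶠ f 𝒜.≋ Λᶠ g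
    Λᵗ-resp (node _ p)    = 𝒜.·x-cong (Λᶠ-resp p)
    Λᶠ-resp (refl p)      = Λᶠ-respᵖ p
    Λᶠ-resp (prep p q)    = 𝒜.⋄-cong (Λᵗ-resp p) (Λᶠ-resp q)
    Λᶠ-resp (swap {ys = f} {x′ = t} {y′ = u} p q r) = 𝒜.trans
      (𝒜.⋄-cong (Λᵗ-resp p) (𝒜.⋄-cong (Λᵗ-resp q) (Λᶠ-resp r)))
      (𝒜.⋄-left-comm (Λᵗ t) (Λᵗ u) (Λᶠ f))
    Λᶠ-resp (trans p q)   = 𝒜.trans (Λᶠ-resp p) (Λᶠ-resp q)
    Λᶠ-respᵖ []           = 𝒜.refl
    Λᶠ-respᵖ (p ∷ q)      = 𝒜.⋄-cong (Λᵗ-resp p) (Λᶠ-respᵖ q)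

    Λ : LinearMap RootedForests (≡.setoid ℕ)
    Λ = record { to = Λᶠ ; cong = Λᶠ-resp }

    δᵗ : Tree ⊤ → Carrier
    δᵗ (node _ [])      = 1#
    δᵗ (node _ (_ ∷ _)) = 0#

    δᶠ : Forest ⊤ → Carrier
    δᶠ []      = 1#
    δᶠ (t ∷ f) = δᵗ t * δᶠ f

    δ-branches : ∀ {f g} → f ≃ᶠ g → δᵗ (B₊ f) ≈ δᵗ (B₊ g)
    δ-branches (refl [])      = ≈-refl
    δ-branches (refl (_ ∷ _)) = ≈-refl
    δ-branches (prep _ _)     = ≈-refl
    δ-branches (swap _ _ _)   = ≈-refl
    δ-branches (trans p q)    = ≈-trans (δ-branches p) (δ-branches q)

    δᵗ-resp : ∀ {t u} → t ≃ u → δᵗ t ≈ δᵗ u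
    δᵗ-resp (node _ p) = δ-branches p

    δᶠ-resp  : ∀ {f g} → f ≃ᶠ g → δᶠ f ≈ δᶠ g
    δᶠ-respᵖ : ∀ {f g} → Pointwise _≃_ f g → δᶠ f ≈ δᶠ g
    δᶠ-resp (refl p)     = δᶠ-respᵖ p
    δᶠ-resp (prep p q)   = *-cong (δᵗ-resp p) (δᶠ-resp q)
    δᶠ-resp (swap p q r) = ≈-trans
      (*-cong (δᵗ-resp p) (*-cong (δᵗ-resp q) (δᶠ-resp r))) (x∙yz≈y∙xz _ _ _)
      where open CommutativeSemigroupProperties *-commutativeSemigroup using (x∙yz≈y∙xz)
    δᶠ-resp (trans p q)  = ≈-trans (δᶠ-resp p) (δᶠ-resp q)
    δᶠ-respᵖ []          = ≈-refl
    δᶠ-respᵖ (p ∷ q)     = *-cong (δᵗ-resp p) (δᶠ-respᵖ q)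

    δ : Functional RootedForests
    δ = record { to = δᶠ ; cong = δᶠ-resp }

{-# OPTIONS --safe #-}

-- It suffices that (δ − ε)^{*n}(f) = (δ̃ − ε)^{*n}(Λ f) for all forests f and all n. Convolving
-- with χ − ε is a difference operator, χ^{*(m+1)} = χ^{*m} + (χ − ε) * χ^{*m}, so the powers of
-- χ − ε are determined by those of χ, and it suffices to compare δ^{*m} with δ̃^{*m} ∘ Λ. Both
-- are characters, and both satisfy X_{m+1}(B₊ f) = X_m(B₊ f) + X_m(f), the latter because
-- δ̃^{*m}(xⁿ) is the binomial coefficient (m choose n); these rules determine the values on forests.
module Submission where

open import Defs
open import Level using (Level)
open import Algebra.Apartness.Bundles using (HeytingField)
open import Algebra.Bundles using (CommutativeRing)
import Algebra.Properties.CommutativeSemigroup as CommutativeSemigroupProperties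
import Algebra.Properties.Group as GroupProperties
import Algebra.Properties.Ring as RingProperties
open import Data.Bool using (Bool; true; false; _∧_; _∨_; not; if_then_else_)
open import Data.List using (List; []; _∷_; _++_; map; concatMap; filter; cartesianProductWith)
open import Data.List.Properties using (++-identityʳ)
import Data.List.Relation.Unary.All as All
import Data.List.Relation.Unary.All.Properties as All
import Data.List.Membership.DecPropositional as DecMembership
open import Data.Nat using (ℕ; zero; suc; _<_; _≤_; s≤s; NonZero)
import Data.Nat as ℕ
import Data.Nat.Properties as ℕ
open import Data.Product using (_×_; _,_)
open import Data.Unit using (⊤; tt)
open import Function using (Func; _∘_)
open import Relation.Binary.Bundles using (Setoid)
open import Relation.Binary.PropositionalEquality as ≡ using (_≡_)
import Relation.Binary.Reasoning.Setoid as SetoidReasoning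
open import Relation.Nullary using (does)

open DecMembership _≟_ using (_∈?_)

-- Linear functionals evaluated on formal combinations.

module LinearEvaluation {c ℓ} (R : CommutativeRing c ℓ) where

  open CommutativeRing R
  open Linear R
  open SetoidReasoning setoid
  open CommutativeSemigroupProperties +-commutativeSemigroup using (interchange)
  open CommutativeSemigroupProperties *-commutativeSemigroup using (x∙yz≈y∙xz)

  module _ {B : Setoid Level.zero Level.zero} where
    open FreeModule B using (_·_)

    ⟨⟩-congˡ : ∀ (f g : Functional B) → (∀ b → Func.to f b ≈ Func.to g b) →
               ∀ u → f ⟨ u ⟩ ≈ g ⟨ u ⟩
    ⟨⟩-congˡ f g p []            = refl
    ⟨⟩-congˡ f g p ((a , b) ∷ u) = +-cong (*-congˡ (p b)) (⟨⟩-congˡ f g p u)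

    -- The sum enters as a functional `h` with a pointwise equation, so that a convolution or a
    -- partial sum with the right values can take its place.
    ⟨⟩-+ : ∀ (h f g : Functional B) → (∀ b → Func.to h b ≈ Func.to f b + Func.to g b) →
           ∀ u → h ⟨ u ⟩ ≈ f ⟨ u ⟩ + g ⟨ u ⟩
    ⟨⟩-+ h f g p []            = sym (+-identityˡ 0#)
    ⟨⟩-+ h f g p ((a , b) ∷ u) = begin
      a * Func.to h b + h ⟨ u ⟩
        ≈⟨ +-cong (trans (*-congˡ (p b)) (distribˡ a _ _)) (⟨⟩-+ h f g p u) ⟩
      (a * Func.to f b + a * Func.to g b) + (f ⟨ u ⟩ + g ⟨ u ⟩)
        ≈⟨ interchange _ _ _ _ ⟩
      (a * Func.to f b + f ⟨ u ⟩) + (a * Func.to g b + g ⟨ u ⟩) ∎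

    ⟨⟩-* : ∀ (h f : Functional B) x → (∀ b → Func.to h b ≈ x * Func.to f b) →
           ∀ u → h ⟨ u ⟩ ≈ x * f ⟨ u ⟩
    ⟨⟩-* h f x p []            = sym (zeroʳ x)
    ⟨⟩-* h f x p ((a , b) ∷ u) = begin
      a * Func.to h b + h ⟨ u ⟩
        ≈⟨ +-cong (trans (*-congˡ (p b)) (x∙yz≈y∙xz a x _)) (⟨⟩-* h f x p u) ⟩
      x * (a * Func.to f b) + x * f ⟨ u ⟩
        ≈⟨ distribˡ x _ _ ⟨
      x * (a * Func.to f b + f ⟨ u ⟩) ∎

    ⟨⟩-++ : ∀ (f : Functional B) u v → f ⟨ u ++ v ⟩ ≈ f ⟨ u ⟩ + f ⟨ v ⟩
    ⟨⟩-++ f []      v = sym (+-identityˡ _)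
    ⟨⟩-++ f (_ ∷ u) v = trans (+-congˡ (⟨⟩-++ f u v)) (sym (+-assoc _ _ _))

    ⟨⟩-· : ∀ (f : Functional B) a u → f ⟨ a · u ⟩ ≈ a * f ⟨ u ⟩
    ⟨⟩-· f a []            = sym (zeroʳ a)
    ⟨⟩-· f a ((x , b) ∷ u) =
      trans (+-cong (*-assoc a x _) (⟨⟩-· f a u)) (sym (distribˡ a _ _))

    ⟨η⟩ : ∀ (f : Functional B) b → f ⟨ FreeModule.η B b ⟩ ≈ Func.to f b
    ⟨η⟩ f b = trans (+-identityʳ _) (*-identityˡ _)

  module _ {B C : Setoid Level.zero Level.zero} where

    -- Reduces an identity for a linear extension to basis elements, once the composite is available
    -- as a functional `h`.
    ⟨bind⟩ : ∀ (f : Functional C) (h : Functional B) (g : Setoid.Carrier B → Comb C) →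
             (∀ b → f ⟨ g b ⟩ ≈ Func.to h b) → ∀ u → f ⟨ bind {B} {C} g u ⟩ ≈ h ⟨ u ⟩
    ⟨bind⟩ f h g p []            = refl
    ⟨bind⟩ f h g p ((a , b) ∷ u) = trans (⟨⟩-++ f (FreeModule._·_ C a (g b)) _)
      (+-cong (trans (⟨⟩-· f a (g b)) (*-congˡ (p b))) (⟨bind⟩ f h g p u))

  -- Finite sums of scalars, with Boolean conditions on the summands.

  ∑ : {X : Set} → List X → (X → Carrier) → Carrier
  ∑ []       F = 0#
  ∑ (x ∷ xs) F = F x + ∑ xs F

  module _ {X : Set} where

    ∑-cong : ∀ (xs : List X) {F G} → (∀ x → F x ≈ G x) → ∑ xs F ≈ ∑ xs G
    ∑-cong []       p = refl
    ∑-cong (x ∷ xs) p = +-cong (p x) (∑-cong xs p)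

    ∑-zero : ∀ (xs : List X) → ∑ xs (λ _ → 0#) ≈ 0#
    ∑-zero []       = refl
    ∑-zero (_ ∷ xs) = trans (+-identityˡ _) (∑-zero xs)

    ∑-+ : ∀ (xs : List X) F G → ∑ xs (λ x → F x + G x) ≈ ∑ xs F + ∑ xs G
    ∑-+ []       F G = sym (+-identityˡ 0#)
    ∑-+ (x ∷ xs) F G = trans (+-congˡ (∑-+ xs F G)) (interchange _ _ _ _)

    ∑-++ : ∀ (xs ys : List X) F → ∑ (xs ++ ys) F ≈ ∑ xs F + ∑ ys F
    ∑-++ []       ys F = sym (+-identityˡ _)
    ∑-++ (x ∷ xs) ys F = trans (+-congˡ (∑-++ xs ys F)) (sym (+-assoc _ _ _))

  module _ {X Y : Set} where

    ∑-map : ∀ (g : X → Y) xs F → ∑ (map g xs) F ≡ ∑ xs (F ∘ g)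
    ∑-map g []       F = ≡.refl
    ∑-map g (x ∷ xs) F = ≡.cong (F (g x) +_) (∑-map g xs F)

    ∑-concatMap : ∀ (g : X → List Y) xs F → ∑ (concatMap g xs) F ≈ ∑ xs (λ x → ∑ (g x) F)
    ∑-concatMap g []       F = refl
    ∑-concatMap g (x ∷ xs) F = trans (∑-++ (g x) _ F) (+-congˡ (∑-concatMap g xs F))

  ∑-cartesian : ∀ {X Y Z : Set} (g : X → Y → Z) xs ys F →
                ∑ (cartesianProductWith g xs ys) F ≈ ∑ xs (λ x → ∑ ys (λ y → F (g x y)))
  ∑-cartesian g []       ys F = refl
  ∑-cartesian g (x ∷ xs) ys F = trans (∑-++ (map (g x) ys) _ F)
    (+-cong (reflexive (∑-map (g x) ys F)) (∑-cartesian g xs ys F))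

  -- Replaces filtering: a filtered sum becomes a sum over the whole list, so a condition on a
  -- forest can be split among its trees.
  when : Bool → Carrier → Carrier
  when b x = if b then x else 0#

  when-∧ : ∀ a b x → when (a ∧ b) x ≡ when a (when b x)
  when-∧ true  b x = ≡.refl
  when-∧ false b x = ≡.refl

  when-cong : ∀ b {x y} → x ≈ y → when b x ≈ when b y
  when-cong true  p = p
  when-cong false p = refl

  ∑-when : ∀ {X : Set} b (xs : List X) F → ∑ xs (λ x → when b (F x)) ≈ when b (∑ xs F)
  ∑-when true  xs F = refl
  ∑-when false xs F = ∑-zero xs

-- Convolution powers of `χ` and of `χ − ε`.

module Powers {c ℓ₁ ℓ₂ : Level} (K : HeytingField c ℓ₁ ℓ₂) (char0 : CharacteristicZero K) where

  private
    R : CommutativeRing c ℓ₁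
    R = underlyingRing K
  open CommutativeRing R
  open Convolution K char0
  open LinearEvaluation R
  open SetoidReasoning setoid
  open GroupProperties +-group using (∙-cancelˡ)

  module Differences (C : ConnectedGraded) where
    open ConnectedGraded C
    open Logarithm C

    -- `ConnectedGraded` does not record the counit law; it enters as a hypothesis and is proved
    -- later for each of the two Hopf algebras.
    LeftCounit : Set _
    LeftCounit = ∀ X b → Func.to (ε ∗ X) b ≈ Func.to X b

    -- The sum of the degrees serves as a common upper bound for them.
    bound : Comb Basis → ℕ
    bound []            = 0
    bound ((_ , d) ∷ v) = deg d ℕ.+ bound v

    module _ (χ : Functional Basis) where

      -- (χ − ε)^{*n} * χ^{*m}
      mixedPower : ℕ → ℕ → Functional Basis
      mixedPower zero    m = χ ^∗ m
      mixedPower (suc n) m = (χ − ε) ∗ mixedPower n m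

      mixedPower-zero : ∀ n b → Func.to (mixedPower n 0) b ≈ Func.to ((χ − ε) ^∗ n) b
      mixedPower-zero zero    b = refl
      mixedPower-zero (suc n) b = ⟨⟩-congˡ ((χ − ε) ⊗ mixedPower n 0) ((χ − ε) ⊗ (χ − ε) ^∗ n)
        (λ (b₁ , b₂) → *-congˡ (mixedPower-zero n b₂)) (Func.to Δ b)

      partialSum : ℕ → Functional Basis
      partialSum N = record { to = logPartialSum χ N ; cong = logPartialSum-cong χ N }

      -- On each basis element the partial sums are stable from its degree on, so one `N` above all
      -- degrees works for the whole combination.
      partialSum-converges : Func.to χ 𝟏 ≈ 1# → ∀ v N → bound v ≤ N →
                             partialSum N ⟨ v ⟩ ≈ log* χ ⟨ v ⟩
      partialSum-converges χ𝟏 []            N p = refl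
      partialSum-converges χ𝟏 ((a , d) ∷ v) N p = +-cong
        (*-congˡ (log*-converges χ χ𝟏 d N (ℕ.≤-trans (ℕ.m≤m+n (deg d) (bound v)) p)))
        (partialSum-converges χ𝟏 v N (ℕ.≤-trans (ℕ.m≤n+m (bound v) (deg d)) p))

      module _ (counitˡ : LeftCounit) where

        difference-∗ : ∀ X b → Func.to (χ ∗ X) b ≈ Func.to X b + Func.to ((χ − ε) ∗ X) b
        difference-∗ X b = trans
          (⟨⟩-+ (χ ⊗ X) (ε ⊗ X) ((χ − ε) ⊗ X) split (Func.to Δ b)) (+-congʳ (counitˡ X b))
          where
          split : ∀ bb → Func.to (χ ⊗ X) bb ≈ Func.to (ε ⊗ X) bb + Func.to ((χ − ε) ⊗ X) bb
          split (b₁ , b₂) = sym (trans (sym (distribʳ _ _ _)) (*-congʳ (begin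
            e + (x - e)       ≈⟨ +-comm e (x - e) ⟩
            x - e + e         ≈⟨ +-assoc x (- e) e ⟩
            x + (- e + e)     ≈⟨ +-congˡ (-‿inverseˡ e) ⟩
            x + 0#            ≈⟨ +-identityʳ x ⟩
            x                 ∎)))
            where
            x = Func.to χ b₁
            e = Func.to ε b₁

        -- For `n = 0` this is `difference-∗`. Each further factor `χ − ε` is added on the left, and
        -- convolution is linear in its right argument.
        mixedPower-suc : ∀ n m b → Func.to (mixedPower n (suc m)) b ≈
                         Func.to (mixedPower n m) b + Func.to (mixedPower (suc n) m) b
        mixedPower-suc zero    m b = difference-∗ (χ ^∗ m) b
        mixedPower-suc (suc n) m b = ⟨⟩-+
          ((χ − ε) ⊗ mixedPower n (suc m)) ((χ − ε) ⊗ mixedPower n m)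
          ((χ − ε) ⊗ mixedPower (suc n) m)
          (λ (b₁ , b₂) → trans (*-congˡ (mixedPower-suc n m b₂)) (distribˡ _ _ _)) (Func.to Δ b)

  -- Transfer from powers of characters to their logarithms.

  module Comparison (C D : ConnectedGraded) where
    private
      module C where
        open ConnectedGraded C public
        open Logarithm C public
        open Differences C public
      module D where
        open ConnectedGraded D public
        open Logarithm D public
        open Differences D public

    module _ (χ : Functional C.Basis) (ψ : Functional D.Basis)
             (counitᶜ : C.LeftCounit) (counitᵈ : D.LeftCounit)
             (b : Setoid.Carrier C.Basis) (u : Comb D.Basis) where

      module _ (agree : ∀ m → Func.to (χ C.^∗ m) b ≈ (ψ D.^∗ m) ⟨ u ⟩) where

        -- By `mixedPower-suc` the entry at `(n + 1, m)` is the difference of those at `(n, m + 1)`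
        -- and `(n, m)`. Hence the row `n = 0`, known for all `m`, determines every other row, while
        -- `b` and `u` stay fixed.
        mixedPowers-agree : ∀ n m → Func.to (C.mixedPower χ n m) b ≈ D.mixedPower ψ n m ⟨ u ⟩
        mixedPowers-agree zero    m = agree m
        mixedPowers-agree (suc n) m = ∙-cancelˡ (Func.to (C.mixedPower χ n m) b) _ _ (begin
          Func.to (C.mixedPower χ n m) b + Func.to (C.mixedPower χ (suc n) m) b
            ≈⟨ C.mixedPower-suc χ counitᶜ n m b ⟨
          Func.to (C.mixedPower χ n (suc m)) b
            ≈⟨ mixedPowers-agree n (suc m) ⟩
          D.mixedPower ψ n (suc m) ⟨ u ⟩
            ≈⟨ ⟨⟩-+ (D.mixedPower ψ n (suc m)) (D.mixedPower ψ n m) (D.mixedPower ψ (suc n) m)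
                 (D.mixedPower-suc ψ counitᵈ n m) u ⟩
          D.mixedPower ψ n m ⟨ u ⟩ + D.mixedPower ψ (suc n) m ⟨ u ⟩
            ≈⟨ +-congʳ (mixedPowers-agree n m) ⟨
          Func.to (C.mixedPower χ n m) b + D.mixedPower ψ (suc n) m ⟨ u ⟩ ∎)

        reducedPowers-agree : ∀ n → Func.to ((χ C.− C.ε) C.^∗ n) b ≈ ((ψ D.− D.ε) D.^∗ n) ⟨ u ⟩
        reducedPowers-agree n = begin
          Func.to ((χ C.− C.ε) C.^∗ n) b  ≈⟨ C.mixedPower-zero χ n b ⟨
          Func.to (C.mixedPower χ n 0) b  ≈⟨ mixedPowers-agree n 0 ⟩
          D.mixedPower ψ n 0 ⟨ u ⟩
            ≈⟨ ⟨⟩-congˡ (D.mixedPower ψ n 0) ((ψ D.− D.ε) D.^∗ n) (D.mixedPower-zero ψ n) u ⟩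
          ((ψ D.− D.ε) D.^∗ n) ⟨ u ⟩      ∎

        partialSums-agree : ∀ N → C.logPartialSum χ N b ≈ D.partialSum ψ N ⟨ u ⟩
        partialSums-agree zero    = sym (D.⟨⟩-vanishes (D.partialSum ψ 0) (All.universal (λ _ → refl) u))
        partialSums-agree (suc N) = begin
          C.logPartialSum χ N b + a * Func.to ((χ C.− C.ε) C.^∗ suc N) b
            ≈⟨ +-cong (partialSums-agree N) (*-congˡ (reducedPowers-agree (suc N))) ⟩
          D.partialSum ψ N ⟨ u ⟩ + a * ((ψ D.− D.ε) D.^∗ suc N) ⟨ u ⟩
            ≈⟨ +-congˡ (⟨⟩-* term ((ψ D.− D.ε) D.^∗ suc N) a (λ _ → refl) u) ⟨
          D.partialSum ψ N ⟨ u ⟩ + term ⟨ u ⟩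
            ≈⟨ ⟨⟩-+ (D.partialSum ψ (suc N)) (D.partialSum ψ N) term (λ _ → refl) u ⟨
          D.partialSum ψ (suc N) ⟨ u ⟩ ∎
          where
          a = (- 1#) ^ (suc N ℕ.+ 1) * (1/ suc N)
          term : Functional D.Basis
          term = record { to   = D.logTerm ψ (suc N)
                        ; cong = λ p → *-congˡ (Func.cong ((ψ D.− D.ε) D.^∗ suc N) p) }

        logs-agree : Func.to χ C.𝟏 ≈ 1# → Func.to ψ D.𝟏 ≈ 1# →
                     Func.to (C.log* χ) b ≈ D.log* ψ ⟨ u ⟩
        logs-agree χ𝟏 ψ𝟏 = begin
          Func.to (C.log* χ) b     ≈⟨ C.log*-converges χ χ𝟏 b N (ℕ.m≤m+n (C.deg b) (D.bound u)) ⟨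
          C.logPartialSum χ N b    ≈⟨ partialSums-agree N ⟩
          D.partialSum ψ N ⟨ u ⟩       ≈⟨ D.partialSum-converges ψ ψ𝟏 u N (ℕ.m≤n+m (D.bound u) (C.deg b)) ⟩
          D.log* ψ ⟨ u ⟩           ∎
          -- A single cutoff that is large enough for both logarithms.
          where N = C.deg b ℕ.+ D.bound u

-- Powers of `δ̃` on the quasi-shuffle algebra.

module QuasiShufflePowers
  {c ℓ₁ ℓ₂ : Level} (K : HeytingField c ℓ₁ ℓ₂) (char0 : CharacteristicZero K) where

  private
    R : CommutativeRing c ℓ₁
    R = underlyingRing K
  open CommutativeRing R
  open HopfAlgebras K char0
  open QuasiShuffle using (𝒜-graded; δ̃; ε𝒜; _·x; _⋄ᵇ_; _⋄_; extend)
  open Logarithm 𝒜-graded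
  open Powers K char0
  open Differences 𝒜-graded using (LeftCounit)
  open LinearEvaluation R
  open SetoidReasoning setoid
  open RingProperties ring using (-0#≈0#)
  open CommutativeSemigroupProperties +-commutativeSemigroup using (interchange)

  Function : Set _
  Function = Functional (≡.setoid ℕ)

  ∗-at-0 : ∀ (f g : Function) → Func.to (f ∗ g) 0 ≈ Func.to f 0 * Func.to g 0
  ∗-at-0 f g = ⟨η⟩ (f ⊗ g) (0 , 0)

  -- In the deconcatenation only the terms with left factor of degree 0 or 1 survive, as `f`
  -- vanishes from degree 2 on.
  ∗-at-suc : ∀ (f g : Function) → (∀ n → Func.to f (2 ℕ.+ n) ≈ 0#) → ∀ s →
             Func.to (f ∗ g) (suc s) ≈ Func.to f 0 * Func.to g (suc s) + Func.to f 1 * Func.to g s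
  ∗-at-suc f g p s = +-cong (*-identityˡ _) (trans (+-cong (*-identityˡ _)
    (⟨⟩-vanishes (f ⊗ g) (All.map⁺ (All.applyUpTo⁺₂ (λ i → 2 ℕ.+ i) s
      (λ i → trans (*-congʳ (p i)) (zeroˡ _))))))
    (+-identityʳ _))

  counitˡ : LeftCounit
  counitˡ X zero    = trans (∗-at-0 ε𝒜 X) (*-identityˡ _)
  counitˡ X (suc s) = trans (∗-at-suc ε𝒜 X (λ _ → refl) s)
    (trans (+-cong (*-identityˡ _) (zeroˡ _)) (+-identityʳ _))

  -- Pascal's rule, when `X` is a power of `δ̃`.
  δ̃∗-suc : ∀ X s → Func.to (δ̃ ∗ X) (suc s) ≈ Func.to X (suc s) + Func.to X s
  δ̃∗-suc X s = trans (∗-at-suc δ̃ X (λ _ → refl) s) (+-cong (*-identityˡ _) (*-identityˡ _))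

  -- The coordinate functional of x: it is 1 there and 0 on all other powers. Convolving with it on
  -- the left therefore shifts the degree by one.
  φ̃ : Function
  φ̃ = δ̃ − ε𝒜

  x-0≈x : ∀ x → x - 0# ≈ x
  x-0≈x x = trans (+-congˡ -0#≈0#) (+-identityʳ x)

  φ̃∗-suc : ∀ X s → Func.to (φ̃ ∗ X) (suc s) ≈ Func.to X s
  φ̃∗-suc X s = trans (∗-at-suc φ̃ X (λ _ → x-0≈x 0#) s)
    (trans (+-cong (trans (*-congʳ (-‿inverseʳ 1#)) (zeroˡ _))
                   (trans (*-congʳ (x-0≈x 1#)) (*-identityˡ _)))
           (+-identityˡ _))

  φ̃^-diagonal : ∀ s → Func.to (φ̃ ^∗ s) s ≈ 1#
  φ̃^-diagonal zero    = refl
  φ̃^-diagonal (suc s) = trans (φ̃∗-suc (φ̃ ^∗ s) s) (φ̃^-diagonal s)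

  φ̃^-below : ∀ n s → n < s → Func.to (φ̃ ^∗ n) s ≈ 0#
  φ̃^-below zero    (suc s) p       = refl
  φ̃^-below (suc n) (suc s) (s≤s p) = trans (φ̃∗-suc (φ̃ ^∗ n) s) (φ̃^-below n s p)

  logPartialSum-below : ∀ N s → N < s → logPartialSum δ̃ N s ≈ 0#
  logPartialSum-below zero    s p = refl
  logPartialSum-below (suc N) s p = trans
    (+-cong (logPartialSum-below N s (ℕ.<-trans (ℕ.n<1+n N) p))
            (trans (*-congˡ (φ̃^-below (suc N) s p)) (zeroʳ _)))
    (+-identityʳ 0#)

  -- The partial sum at degree `s` stops at `n = s`. All earlier powers of `φ̃` vanish on this basis
  -- element, and the last one is 1.
  log-δ̃ : ∀ s .{{_ : NonZero s}} → Func.to (log* δ̃) s ≈ (- 1#) ^ (s ℕ.+ 1) * (1/ s)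
  log-δ̃ (suc s) = trans
    (+-cong (logPartialSum-below s (suc s) (ℕ.n<1+n s))
            (trans (*-congˡ (φ̃^-diagonal (suc s))) (*-identityʳ _)))
    (+-identityˡ _)

  δ̃^-𝟏 : ∀ m → Func.to (δ̃ ^∗ m) 0 ≈ 1#
  δ̃^-𝟏 zero    = refl
  δ̃^-𝟏 (suc m) = trans (∗-at-0 δ̃ (δ̃ ^∗ m)) (trans (*-identityˡ _) (δ̃^-𝟏 m))

  ε-·x : ∀ u → ε𝒜 ⟨ u ·x ⟩ ≈ 0#
  ε-·x []            = refl
  ε-·x ((a , n) ∷ u) = trans (+-cong (zeroʳ a) (ε-·x u)) (+-identityˡ 0#)

  -- Pascal's rule extended linearly; with `u` the image of a forest under `Λ`, it mirrors the
  -- recursion of the powers of `δ` at `B₊`.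
  δ̃∗-·x : ∀ X u → (δ̃ ∗ X) ⟨ u ·x ⟩ ≈ X ⟨ u ·x ⟩ + X ⟨ u ⟩
  δ̃∗-·x X []            = sym (+-identityˡ 0#)
  δ̃∗-·x X ((a , n) ∷ u) = trans
    (+-cong (trans (*-congˡ (δ̃∗-suc X n)) (distribˡ a _ _)) (δ̃∗-·x X u))
    (interchange _ _ _ _)

  ⟨⟩-++₃ : ∀ (X : Function) u v w → X ⟨ u ++ v ++ w ⟩ ≈ X ⟨ u ⟩ + (X ⟨ v ⟩ + X ⟨ w ⟩)
  ⟨⟩-++₃ X u v w = trans (⟨⟩-++ X u (v ++ w)) (+-congˡ (⟨⟩-++ X v w))

  -- Induction on `m`, for all `k` and `l` at once. When both exponents are positive, Pascal's rule
  -- is applied to each of the three terms that define the product.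
  δ̃^-⋄ᵇ : ∀ m k l → (δ̃ ^∗ m) ⟨ k ⋄ᵇ l ⟩ ≈ Func.to (δ̃ ^∗ m) k * Func.to (δ̃ ^∗ m) l
  δ̃^-⋄ᵇ m       zero    l    = trans (⟨η⟩ (δ̃ ^∗ m) l) (sym (trans (*-congʳ (δ̃^-𝟏 m)) (*-identityˡ _)))
  δ̃^-⋄ᵇ m       (suc k) zero =
    trans (⟨η⟩ (δ̃ ^∗ m) (suc k)) (sym (trans (*-congˡ (δ̃^-𝟏 m)) (*-identityʳ _)))
  δ̃^-⋄ᵇ zero    (suc k) (suc l) = begin
    ε𝒜 ⟨ p ·x ++ q ·x ++ r ·x ⟩                   ≈⟨ ⟨⟩-++₃ ε𝒜 (p ·x) (q ·x) (r ·x) ⟩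
    ε𝒜 ⟨ p ·x ⟩ + (ε𝒜 ⟨ q ·x ⟩ + ε𝒜 ⟨ r ·x ⟩)
      ≈⟨ +-cong (ε-·x p) (trans (+-cong (ε-·x q) (ε-·x r)) (+-identityˡ 0#)) ⟩
    0# + 0#                                       ≈⟨ +-identityˡ 0# ⟩
    0#                                            ≈⟨ zeroˡ 0# ⟨
    0# * 0#                                       ∎
    where
    p = k ⋄ᵇ suc l
    q = suc k ⋄ᵇ l
    r = k ⋄ᵇ l
  δ̃^-⋄ᵇ (suc m) (suc k) (suc l) = begin
    (δ̃ ∗ X) ⟨ p ·x ++ q ·x ++ r ·x ⟩
      ≈⟨ ⟨⟩-++₃ (δ̃ ∗ X) (p ·x) (q ·x) (r ·x) ⟩
    (δ̃ ∗ X) ⟨ p ·x ⟩ + ((δ̃ ∗ X) ⟨ q ·x ⟩ + (δ̃ ∗ X) ⟨ r ·x ⟩)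
      ≈⟨ +-cong (δ̃∗-·x X p) (trans (+-cong (δ̃∗-·x X q) (δ̃∗-·x X r)) (interchange _ _ _ _)) ⟩
    (X ⟨ p ·x ⟩ + X ⟨ p ⟩) + ((X ⟨ q ·x ⟩ + X ⟨ r ·x ⟩) + (X ⟨ q ⟩ + X ⟨ r ⟩))
      ≈⟨ interchange _ _ _ _ ⟩
    (X ⟨ p ·x ⟩ + (X ⟨ q ·x ⟩ + X ⟨ r ·x ⟩)) + (X ⟨ p ⟩ + (X ⟨ q ⟩ + X ⟨ r ⟩))
      ≈⟨ +-congʳ (⟨⟩-++₃ X (p ·x) (q ·x) (r ·x)) ⟨
    X ⟨ suc k ⋄ᵇ suc l ⟩ + (X ⟨ p ⟩ + (X ⟨ q ⟩ + X ⟨ r ⟩))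
      ≈⟨ +-cong (δ̃^-⋄ᵇ m (suc k) (suc l))
           (+-cong (δ̃^-⋄ᵇ m k (suc l)) (+-cong (δ̃^-⋄ᵇ m (suc k) l) (δ̃^-⋄ᵇ m k l))) ⟩
    -- These four terms are the expansion of Pascal's rule in both factors; the contraction term `r`
    -- of the quasi-shuffle product supplies `a * b`.
    a₁ * b₁ + (a * b₁ + (a₁ * b + a * b))
      ≈⟨ +-assoc _ _ _ ⟨
    (a₁ * b₁ + a * b₁) + (a₁ * b + a * b)
      ≈⟨ +-cong (distribʳ b₁ a₁ a) (distribʳ b a₁ a) ⟨
    (a₁ + a) * b₁ + (a₁ + a) * b
      ≈⟨ distribˡ (a₁ + a) b₁ b ⟨
    (a₁ + a) * (b₁ + b)
      ≈⟨ *-cong (δ̃∗-suc X k) (δ̃∗-suc X l) ⟨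
    Func.to (δ̃ ∗ X) (suc k) * Func.to (δ̃ ∗ X) (suc l) ∎
    where
    X = δ̃ ^∗ m
    p = k ⋄ᵇ suc l
    q = suc k ⋄ᵇ l
    r = k ⋄ᵇ l
    a₁ = Func.to X (suc k)
    a = Func.to X k
    b₁ = Func.to X (suc l)
    b = Func.to X l

  δ̃^-⋄ : ∀ m u v → (δ̃ ^∗ m) ⟨ u ⋄ v ⟩ ≈ (δ̃ ^∗ m) ⟨ u ⟩ * (δ̃ ^∗ m) ⟨ v ⟩
  δ̃^-⋄ m u v = begin
    X ⟨ u ⋄ v ⟩                      ≈⟨ ⟨bind⟩ X Xv (λ k → extend (k ⋄ᵇ_) v) inner u ⟩
    Xv ⟨ u ⟩                         ≈⟨ ⟨⟩-* Xv X (X ⟨ v ⟩) (λ k → *-comm _ _) u ⟩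
    X ⟨ v ⟩ * X ⟨ u ⟩                ≈⟨ *-comm _ _ ⟩
    X ⟨ u ⟩ * X ⟨ v ⟩                ∎
    where
    X = δ̃ ^∗ m
    -- `⟨bind⟩` asks for the values of the inner sum as a functional, here a multiple of `X`.
    scaled : Carrier → Function
    scaled x = record { to = λ k → Func.to X k * x ; cong = λ p → *-congʳ (Func.cong X p) }
    Xv = scaled (X ⟨ v ⟩)
    inner : ∀ k → X ⟨ extend (k ⋄ᵇ_) v ⟩ ≈ Func.to Xv k
    inner k = trans
      (⟨bind⟩ X (scaled (Func.to X k)) (k ⋄ᵇ_) (λ l → trans (δ̃^-⋄ᵇ m k l) (*-comm _ _)) v)
      (⟨⟩-* (scaled (Func.to X k)) X (Func.to X k) (λ l → *-comm _ _) v)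

-- Powers of `δ` on the Connes-Kreimer algebra.

module ConnesKreimerPowers
  {c ℓ₁ ℓ₂ : Level} (K : HeytingField c ℓ₁ ℓ₂) (char0 : CharacteristicZero K) where

  private
    R : CommutativeRing c ℓ₁
    R = underlyingRing K
  open CommutativeRing R
  open HopfAlgebras K char0
  open ConnesKreimer
  open QuasiShuffle using (𝒜-graded; δ̃)
  private
    module 𝒜 = Logarithm 𝒜-graded
  open Logarithm ℋ-graded
  open Powers K char0
  open Differences ℋ-graded using (LeftCounit)
  open QuasiShufflePowers K char0 using (δ̃^-𝟏; δ̃^-⋄; δ̃∗-·x; ε-·x)
  open LinearEvaluation R
  open SetoidReasoning setoid
  open CommutativeSemigroupProperties +-commutativeSemigroup using (interchange)
  open CommutativeSemigroupProperties *-commutativeSemigroup using ()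
    renaming (interchange to *-interchange)

  BiFunction : Set c
  BiFunction = Forest ⊤ → Forest ⊤ → Carrier

  -- The coproduct of a forest, evaluated at a function of pairs, by the recursion
  -- Δ(B₊ f) = B₊ f ⊗ 𝟏 + (id ⊗ B₊)(Δ f), Δ(t f) = Δ(t) Δ(f).
  cutSumᵗ : Tree ⊤ → BiFunction → Carrier
  cutSum  : Forest ⊤ → BiFunction → Carrier
  cutSumᵗ (node _ f) F = F (B₊ f ∷ []) [] + cutSum f (λ v w → F v (B₊ w ∷ []))
  cutSum []          F = F [] []
  cutSum (t ∷ f)     F = cutSumᵗ t (λ v w → cutSum f (λ v₁ w₁ → F (v ++ v₁) (w ++ w₁)))

  -- From decompositions of the vertex set to the recursive coproduct.

  weight : BiFunction → Forest Side → Carrier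
  weight F d = F (induced V d) (induced W d)

  does-∈-++ : ∀ s xs ys → does (s ∈? (xs ++ ys)) ≡ does (s ∈? xs) ∨ does (s ∈? ys)
  does-∈-++ s []       ys = ≡.refl
  does-∈-++ s (x ∷ xs) ys with does (s ≟ x)
  ... | true  = ≡.refl
  ... | false = does-∈-++ s xs ys

  -- The only decomposition that is uncut is the one with all vertices in V.
  uncutᵗ : Tree Side → Bool
  uncutᵗ t = not (does (W ∈? labelsᵗ t)) ∧ does (admissibleᵗ? t)

  uncut : Forest Side → Bool
  uncut d = not (does (W ∈? labels d)) ∧ does (admissible? d)

  uncut-∷ : ∀ t d → uncut (t ∷ d) ≡ uncutᵗ t ∧ uncut d
  uncut-∷ t d = ≡.trans
    (≡.cong (λ b → not b ∧ (does (admissibleᵗ? t) ∧ does (admissible? d)))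
      (does-∈-++ W (labelsᵗ t) (labels d)))
    (shuffle (does (W ∈? labelsᵗ t)) (does (W ∈? labels d)) (does (admissibleᵗ? t)) (does (admissible? d)))
    where
    shuffle : ∀ a b x y → not (a ∨ b) ∧ (x ∧ y) ≡ (not a ∧ x) ∧ (not b ∧ y)
    shuffle true  b     x     y = ≡.refl
    shuffle false true  true  y = ≡.refl
    shuffle false true  false y = ≡.refl
    shuffle false false x     y = ≡.refl

  -- A root in `V` makes admissibility demand that no `W` occurs above it, which `uncutᵗ` demands
  -- already; hence idempotence.
  uncut-node : ∀ d → uncutᵗ (node V d) ≡ uncut d
  uncut-node d = idem (does (W ∈? labels d)) (does (admissible? d))
    where
    idem : ∀ a x → not a ∧ (not a ∧ x) ≡ not a ∧ x
    idem true  x = ≡.refl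
    idem false x = ≡.refl

  ∑-node : ∀ f (F : Tree Side → Carrier) → ∑ (decompositionsᵗ (node tt f)) F ≈
           ∑ (decompositions f) (F ∘ node V) + ∑ (decompositions f) (F ∘ node W)
  ∑-node f F = trans (∑-concatMap _ (decompositions f) F) (trans
    (∑-cong (decompositions f) (λ d → +-congˡ (+-identityʳ _)))
    (∑-+ (decompositions f) (F ∘ node V) (F ∘ node W)))

  -- The conditions are kept general to cover both `uncut` and admissibility.
  ∑-∷ : ∀ t f (a : Tree Side → Bool) (b : Forest Side → Bool) (F : Tree Side → Forest Side → Carrier)
        (G : Forest Side → Carrier) → (∀ u d → G (u ∷ d) ≈ when (a u ∧ b d) (F u d)) →
        ∑ (decompositions (t ∷ f)) G ≈
        ∑ (decompositionsᵗ t) (λ u → when (a u) (∑ (decompositions f) (λ d → when (b d) (F u d))))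
  ∑-∷ t f a b F G p = trans (∑-cartesian _∷_ (decompositionsᵗ t) (decompositions f) G)
    (∑-cong (decompositionsᵗ t) (λ u → trans
      (∑-cong (decompositions f) (λ d → trans (p u d) (reflexive (when-∧ (a u) (b d) _))))
      (∑-when (a u) (decompositions f) _)))

  ∑-uncutᵗ : ∀ t F → ∑ (decompositionsᵗ t) (λ u → when (uncutᵗ u) (weight F (u ∷ []))) ≈ F (t ∷ []) []
  ∑-uncut  : ∀ f F → ∑ (decompositions f) (λ d → when (uncut d) (weight F d)) ≈ F f []
  ∑-uncutᵗ (node tt f) F = begin
    _ ≈⟨ ∑-node f (λ u → when (uncutᵗ u) (weight F (u ∷ []))) ⟩
    ∑ (decompositions f) (λ d → when (uncutᵗ (node V d)) (weight F (node V d ∷ [])))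
      -- A root in `W` makes `uncutᵗ` compute to `false`.
      + ∑ (decompositions f) (λ _ → 0#)
      ≈⟨ +-cong (∑-cong (decompositions f) (λ d → reflexive (≡.cong₂ when (uncut-node d)
           (≡.cong (F (B₊ (induced V d) ∷ [])) (++-identityʳ (induced W d))))))
           (∑-zero (decompositions f)) ⟩
    ∑ (decompositions f) (λ d → when (uncut d) (weight (λ v w → F (B₊ v ∷ []) w) d)) + 0#
      ≈⟨ trans (+-identityʳ _) (∑-uncut f (λ v w → F (B₊ v ∷ []) w)) ⟩
    F (B₊ f ∷ []) [] ∎
  ∑-uncut []      F = +-identityʳ _
  ∑-uncut (t ∷ f) F = begin
    _ ≈⟨ ∑-∷ t f uncutᵗ uncut (λ u d → weight F (u ∷ d)) (λ d → when (uncut d) (weight F d))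
           (λ u d → reflexive (≡.cong (λ b → when b (weight F (u ∷ d))) (uncut-∷ u d))) ⟩
    ∑ (decompositionsᵗ t) (λ u → when (uncutᵗ u)
      (∑ (decompositions f) (λ d → when (uncut d) (weight F (u ∷ d)))))
      ≈⟨ ∑-cong (decompositionsᵗ t) (λ u → when-cong (uncutᵗ u) (trans
           (∑-uncut f (λ v w → F (inducedᵗ V u ++ v) (inducedᵗ W u ++ w)))
           (reflexive (≡.cong (λ v → F (v ++ f) (inducedᵗ W u ++ [])) (≡.sym (++-identityʳ (inducedᵗ V u))))))) ⟩
    ∑ (decompositionsᵗ t) (λ u → when (uncutᵗ u) (weight (λ v w → F (v ++ f) w) (u ∷ [])))
      ≈⟨ ∑-uncutᵗ t (λ v w → F (v ++ f) w) ⟩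
    F (t ∷ f) [] ∎

  -- The two terms of the recursion for `cutSumᵗ` are the two sides on which the root can lie. In
  -- `V` it forces everything above it into `V`; in `W` it leaves any admissible decomposition of
  -- the branches.
  ∑-admissibleᵗ : ∀ t F → ∑ (decompositionsᵗ t) (λ u → when (does (admissibleᵗ? u))
                  (F (inducedᵗ V u) (inducedᵗ W u))) ≈ cutSumᵗ t F
  ∑-admissible  : ∀ f F → ∑ (decompositions f) (λ d → when (does (admissible? d)) (weight F d)) ≈ cutSum f F
  ∑-admissibleᵗ (node tt f) F = trans
    (∑-node f (λ u → when (does (admissibleᵗ? u)) (F (inducedᵗ V u) (inducedᵗ W u))))
    -- Admissibility of the tree computes to `uncut` of the branches for a root in `V`, and to their
    -- admissibility for a root in `W`.
    (+-cong (∑-uncut f (λ v w → F (B₊ v ∷ []) w)) (∑-admissible f (λ v w → F v (B₊ w ∷ []))))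
  ∑-admissible []      F = +-identityʳ _
  ∑-admissible (t ∷ f) F = begin
    _ ≈⟨ ∑-∷ t f (does ∘ admissibleᵗ?) (does ∘ admissible?) (λ u d → weight F (u ∷ d))
           (λ d → when (does (admissible? d)) (weight F d)) (λ u d → refl) ⟩
    _ ≈⟨ ∑-cong (decompositionsᵗ t) (λ u → when-cong (does (admissibleᵗ? u))
           (∑-admissible f (λ v w → F (inducedᵗ V u ++ v) (inducedᵗ W u ++ w)))) ⟩
    _ ≈⟨ ∑-admissibleᵗ t (λ v w → cutSum f (λ v₁ w₁ → F (v ++ v₁) (w ++ w₁))) ⟩
    cutSum (t ∷ f) F ∎

  -- Passes from the coproduct by admissible cuts to the recursion, through which convolutions on
  -- forests are computed below.
  ∗-cutSum : ∀ X Y f → Func.to (X ∗ Y) f ≈ cutSum f (λ v w → Func.to X v * Func.to Y w)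
  ∗-cutSum X Y f = trans (go (decompositions f)) (∑-admissible f F)
    where
    F : BiFunction
    F v w = Func.to X v * Func.to Y w
    go : ∀ ds → (X ⊗ Y) ⟨ map cut (filter admissible? ds) ⟩ ≈
         ∑ ds (λ d → when (does (admissible? d)) (weight F d))
    go []       = refl
    go (d ∷ ds) with does (admissible? d)
    ... | true  = +-cong (*-identityˡ _) (go ds)
    ... | false = trans (go ds) (sym (+-identityˡ _))

  -- Linearity of cut sums and the counit law.

  cutSumᵗ-cong : ∀ t {F G} → (∀ v w → F v w ≈ G v w) → cutSumᵗ t F ≈ cutSumᵗ t G
  cutSum-cong  : ∀ f {F G} → (∀ v w → F v w ≈ G v w) → cutSum f F ≈ cutSum f G
  cutSumᵗ-cong (node _ f) p = +-cong (p _ _) (cutSum-cong f (λ v w → p v _))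
  cutSum-cong []          p = p [] []
  cutSum-cong (t ∷ f)     p = cutSumᵗ-cong t (λ v w → cutSum-cong f (λ v₁ w₁ → p _ _))

  cutSumᵗ-+ : ∀ t F G → cutSumᵗ t (λ v w → F v w + G v w) ≈ cutSumᵗ t F + cutSumᵗ t G
  cutSum-+  : ∀ f F G → cutSum f (λ v w → F v w + G v w) ≈ cutSum f F + cutSum f G
  cutSumᵗ-+ (node _ f) F G = trans (+-congˡ (cutSum-+ f _ _)) (interchange _ _ _ _)
  cutSum-+ []          F G = refl
  cutSum-+ (t ∷ f)     F G = trans (cutSumᵗ-cong t (λ v w → cutSum-+ f _ _)) (cutSumᵗ-+ t _ _)

  cutSumᵗ-* : ∀ t a F → cutSumᵗ t (λ v w → a * F v w) ≈ a * cutSumᵗ t F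
  cutSum-*  : ∀ f a F → cutSum f (λ v w → a * F v w) ≈ a * cutSum f F
  cutSumᵗ-* (node _ f) a F = trans (+-congˡ (cutSum-* f a _)) (sym (distribˡ a _ _))
  cutSum-* []          a F = refl
  cutSum-* (t ∷ f)     a F = trans (cutSumᵗ-cong t (λ v w → cutSum-* f a _)) (cutSumᵗ-* t a _)

  cutSum-zero : ∀ f F → (∀ v w → F v w ≈ 0#) → cutSum f F ≈ 0#
  cutSum-zero f F p = trans (cutSum-cong f (λ v w → trans (p v w) (sym (zeroˡ (F v w)))))
    (trans (cutSum-* f 0# F) (zeroˡ _))

  -- Only the cut with nothing above it has an empty first component.
  cutSumᵗ-counit : ∀ t F → (∀ u v w → F (u ∷ v) w ≈ 0#) → cutSumᵗ t F ≈ F [] (t ∷ [])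
  cutSum-counit  : ∀ f F → (∀ u v w → F (u ∷ v) w ≈ 0#) → cutSum f F ≈ F [] f
  cutSumᵗ-counit (node tt f) F p = trans
    (+-cong (p _ _ _) (cutSum-counit f (λ v w → F v (B₊ w ∷ [])) (λ u v w → p u v _)))
    (+-identityˡ _)
  cutSum-counit []      F p = refl
  cutSum-counit (t ∷ f) F p = trans
    (cutSumᵗ-counit t _ (λ u v w → cutSum-zero f _ (λ v₁ w₁ → p u _ _)))
    (cutSum-counit f _ (λ u v w → p u v _))

  counitˡ : LeftCounit
  counitˡ X f = trans (∗-cutSum εℋ X f)
    (trans (cutSum-counit f _ (λ u v w → zeroˡ _)) (*-identityˡ _))

  -- Characters and their convolution.

  record IsCharacter (X : Functional RootedForests) : Set ℓ₁ where
    field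
      unit : Func.to X [] ≈ 1#
      mult : ∀ f g → Func.to X (f ++ g) ≈ Func.to X f * Func.to X g
  open IsCharacter

  ε-character : IsCharacter εℋ
  ε-character = record
    { unit = refl
    ; mult = λ { [] g → sym (*-identityˡ _) ; (t ∷ f) g → sym (zeroˡ _) } }

  δ-character : IsCharacter δ
  δ-character = record { unit = refl ; mult = δ-++ }
    where
    δ-++ : ∀ f g → δᶠ (f ++ g) ≈ δᶠ f * δᶠ g
    δ-++ []      g = sym (*-identityˡ _)
    δ-++ (t ∷ f) g = trans (*-congˡ (δ-++ f g)) (sym (*-assoc _ _ _))

  -- The recursion for `cutSum` at `t ∷ f` has multiplicativity of the coproduct built in;
  -- commutativity of the field then separates the factors belonging to `t` from those belonging to
  -- `f`.
  ∗-character : ∀ {X Y} → IsCharacter X → IsCharacter Y → IsCharacter (X ∗ Y)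
  ∗-character {X} {Y} χ ψ = record
    { unit = trans (∗-cutSum X Y []) F-unit
    ; mult = λ f g → trans (∗-cutSum X Y (f ++ g)) (trans (cutSum-F-++ f g)
        (sym (*-cong (∗-cutSum X Y f) (∗-cutSum X Y g)))) }
    where
    F : BiFunction
    F v w = Func.to X v * Func.to Y w

    F-++ : ∀ v w v₁ w₁ → F (v ++ v₁) (w ++ w₁) ≈ F v w * F v₁ w₁
    F-++ v w v₁ w₁ = trans (*-cong (mult χ v v₁) (mult ψ w w₁)) (*-interchange _ _ _ _)

    F-unit : F [] [] ≈ 1#
    F-unit = trans (*-cong (unit χ) (unit ψ)) (*-identityˡ 1#)

    cutSum-F-∷ : ∀ t f → cutSum (t ∷ f) F ≈ cutSumᵗ t F * cutSum f F
    cutSum-F-∷ t f = begin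
      cutSumᵗ t (λ v w → cutSum f (λ v₁ w₁ → F (v ++ v₁) (w ++ w₁)))
        ≈⟨ cutSumᵗ-cong t (λ v w → trans (cutSum-cong f (F-++ v w))
             (trans (cutSum-* f (F v w) F) (*-comm _ _))) ⟩
      -- The sum over cuts of `f` no longer depends on the cut of `t`, so it factors out.
      cutSumᵗ t (λ v w → cutSum f F * F v w)
        ≈⟨ trans (cutSumᵗ-* t (cutSum f F) F) (*-comm _ _) ⟩
      cutSumᵗ t F * cutSum f F ∎

    cutSum-F-++ : ∀ f g → cutSum (f ++ g) F ≈ cutSum f F * cutSum g F
    cutSum-F-++ []      g = sym (trans (*-congʳ F-unit) (*-identityˡ _))
    cutSum-F-++ (t ∷ f) g = begin
      cutSum (t ∷ f ++ g) F                    ≈⟨ cutSum-F-∷ t (f ++ g) ⟩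
      cutSumᵗ t F * cutSum (f ++ g) F          ≈⟨ *-congˡ (cutSum-F-++ f g) ⟩
      cutSumᵗ t F * (cutSum f F * cutSum g F)  ≈⟨ *-assoc _ _ _ ⟨
      (cutSumᵗ t F * cutSum f F) * cutSum g F  ≈⟨ *-congʳ (cutSum-F-∷ t f) ⟨
      cutSum (t ∷ f) F * cutSum g F            ∎

  δ^-character : ∀ m → IsCharacter (δ ^∗ m)
  δ^-character zero    = ε-character
  δ^-character (suc m) = ∗-character δ-character (δ^-character m)

  -- Powers of `δ` on grafted forests, and comparison through `Λ`.

  -- The cocycle property of `B₊` for the coproduct, paired with `X ⊗ Y`.
  ∗-B₊ : ∀ X Y f → Func.to (X ∗ Y) (B₊ f ∷ []) ≈
         Func.to X (B₊ f ∷ []) * Func.to Y [] + cutSum f (λ v w → Func.to X v * Func.to Y (B₊ w ∷ []))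
  ∗-B₊ X Y f = trans (∗-cutSum X Y (B₊ f ∷ [])) (+-congˡ (cutSum-cong f (λ v w →
    *-congʳ (reflexive (≡.cong (Func.to X) (++-identityʳ v))))))

  δ-B₊ : ∀ f → Func.to δ (B₊ f ∷ []) ≈ Func.to εℋ f
  δ-B₊ []      = *-identityʳ 1#
  δ-B₊ (t ∷ f) = *-identityʳ 0#

  -- For `m = 0`, `δ` after `B₊` is the counit by `δ-B₊`. For larger `m` the induction hypothesis is
  -- applied to the trees `B₊ w` inside the cut sum, which then splits into convolutions at `B₊ f`
  -- and at `f`.
  δ^-B₊ : ∀ m f → Func.to (δ ^∗ suc m) (B₊ f ∷ []) ≈
          Func.to (δ ^∗ m) (B₊ f ∷ []) + Func.to (δ ^∗ m) f
  δ^-B₊ zero    f = begin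
    Func.to (δ ∗ εℋ) (B₊ f ∷ [])
      ≈⟨ ∗-B₊ δ εℋ f ⟩
    Func.to δ (B₊ f ∷ []) * 1# + cutSum f (λ v w → δᶠ v * 0#)
      ≈⟨ +-cong (trans (*-identityʳ _) (δ-B₊ f)) (cutSum-zero f _ (λ v w → zeroʳ _)) ⟩
    Func.to εℋ f + 0#
      -- Here `0#` is the value of the counit at `B₊ f`.
      ≈⟨ +-comm _ _ ⟩
    0# + Func.to εℋ f ∎
  δ^-B₊ (suc m) f = begin
    Func.to (δ ∗ X₁) (B₊ f ∷ [])
      ≈⟨ ∗-B₊ δ X₁ f ⟩
    Func.to δ (B₊ f ∷ []) * Func.to X₁ [] + cutSum f (λ v w → δᶠ v * Func.to X₁ (B₊ w ∷ []))
      -- Both powers are 1 on the empty forest; exchanging them lets the first summand join the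
      -- convolution with `X`.
      ≈⟨ +-cong (*-congˡ (trans (unit (δ^-character (suc m))) (sym (unit (δ^-character m)))))
           (trans (cutSum-cong f (λ v w → trans (*-congˡ (δ^-B₊ m w)) (distribˡ _ _ _)))
                  (cutSum-+ f _ _)) ⟩
    Func.to δ (B₊ f ∷ []) * Func.to X [] +
      (cutSum f (λ v w → δᶠ v * Func.to X (B₊ w ∷ [])) + cutSum f (λ v w → δᶠ v * Func.to X w))
      ≈⟨ +-assoc _ _ _ ⟨
    (Func.to δ (B₊ f ∷ []) * Func.to X [] + cutSum f (λ v w → δᶠ v * Func.to X (B₊ w ∷ []))) +
      cutSum f (λ v w → δᶠ v * Func.to X w)
      ≈⟨ +-cong (∗-B₊ δ X f) (∗-cutSum δ X f) ⟨
    Func.to X₁ (B₊ f ∷ []) + Func.to X₁ f ∎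
    where
    X = δ ^∗ m
    X₁ = δ ^∗ suc m

  -- On forests both sides are multiplicative. On a tree both follow the same recursion in `m`,
  -- since `Λ` turns `B₊` into multiplication by x, and at `m = 0` both counits vanish.
  δ^-Λᵗ : ∀ m t → Func.to (δ ^∗ m) (t ∷ []) ≈ (δ̃ 𝒜.^∗ m) ⟨ Λᵗ t ⟩
  δ^-Λ  : ∀ m f → Func.to (δ ^∗ m) f ≈ (δ̃ 𝒜.^∗ m) ⟨ Λᶠ f ⟩
  δ^-Λᵗ zero    (node tt f) = sym (ε-·x (Λᶠ f))
  δ^-Λᵗ (suc m) (node tt f) = trans (δ^-B₊ m f)
    (trans (+-cong (δ^-Λᵗ m (node tt f)) (δ^-Λ m f)) (sym (δ̃∗-·x (δ̃ 𝒜.^∗ m) (Λᶠ f))))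
  δ^-Λ m []      = trans (unit (δ^-character m)) (sym (trans (⟨η⟩ (δ̃ 𝒜.^∗ m) 0) (δ̃^-𝟏 m)))
  δ^-Λ m (t ∷ f) = trans (mult (δ^-character m) (t ∷ []) f)
    (trans (*-cong (δ^-Λᵗ m t) (δ^-Λ m f)) (sym (δ̃^-⋄ m (Λᵗ t) (Λᶠ f))))

-- Values of the logarithm on powers of x, and its pullback along `Λ`.

mainTheorem16 :
    ∀ {c ℓ₁ ℓ₂ : Level} (K : HeytingField c ℓ₁ ℓ₂) (char0 : CharacteristicZero K) →
    let open HeytingField K
        open HopfAlgebras K char0
        open QuasiShuffle using (x^_)
        open ConnesKreimer using (ℋ)
        Λ = ConnesKreimer.Λ
        ω̃ = Logarithm.log* QuasiShuffle.𝒜-graded QuasiShuffle.δ̃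
        ω = Logarithm.log* ConnesKreimer.ℋ-graded ConnesKreimer.δ
    in ω̃ ⟨ x^ 0 ⟩ ≈ 0#
     × (∀ (s : ℕ) .{{_ : NonZero s}} → ω̃ ⟨ x^ s ⟩ ≈ (- 1#) ^ (s ℕ.+ 1) * (1/ s))
     × (∀ (u : ℋ) → ω ⟨ u ⟩ ≈ ω̃ ⟨ Λ ⟦ u ⟧ ⟩)
mainTheorem16 K char0 =
    -- In degree 0 the logarithm is the empty partial sum.
    ⟨η⟩ ω̃ 0
  , (λ s → trans (⟨η⟩ ω̃ s) (log-δ̃ s))
  , (λ u → sym (⟨bind⟩ ω̃ ω ConnesKreimer.Λᶠ (λ f → sym (logs-agree f)) u))
  where
  open CommutativeRing (underlyingRing K) using (_≈_; refl; sym; trans)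
  open HopfAlgebras K char0
  open LinearEvaluation (underlyingRing K)
  open QuasiShuffle using (𝒜-graded; δ̃)
  open ConnesKreimer using (ℋ-graded; δ)
  open QuasiShufflePowers K char0 using (log-δ̃)
  ω̃ = Logarithm.log* 𝒜-graded δ̃
  ω = Logarithm.log* ℋ-graded δ

  logs-agree : ∀ f → Func.to ω f ≈ ω̃ ⟨ ConnesKreimer.Λᶠ f ⟩
  logs-agree f = Powers.Comparison.logs-agree K char0 ℋ-graded 𝒜-graded δ δ̃
    (ConnesKreimerPowers.counitˡ K char0) (QuasiShufflePowers.counitˡ K char0) f (ConnesKreimer.Λᶠ f)
    -- `δ` and `δ̃` take the value 1 on the unit by computation.
    (λ m → ConnesKreimerPowers.δ^-Λ K char0 m f) refl refl
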